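{- Let $a_1(n),a_2(n),a_3(n),m(n)$ be integer-valued quasi-polynomials with positive leading coefficients. Then $p_{\{a_1(n),a_2(n),a_3(n)\}}(m(n))$, as a function of $n$, is an integer-valued quasi-polynomial (that is, it agrees for all sufficiently large $n$ with an integer-valued quasi-polynomial).
   Context: $\mathbb{N}=\{0,1,2,\dots\}$. An integer-valued quasi-polynomial is a function $f:\mathbb{N}\to\mathbb{Z}$ for which there exist positive integers $T,C$ and polynomials $f_i(x)\in\mathbb{Z}[x]$ ($0\le i\le T-1$) such that $f(n)=f_i(m)$ whenever $n>C$, $n=Tm+i$, $m\in\mathbb{N}$. We say $f$ has positive leading coefficients if all $f_i$ are nonzero with positive leading coefficient; then $f(n)>0$ for all sufficiently large $n$. For positive integers $b_1,b_2,b_3$ and an integer $t$, $p_{\{b_1,b_2,b_3\}}(t)=\#\{(x_1,x_2,x_3)\in\mathbb{Z}^3:\text{ all }x_j\ge0,\ x_1b_1+x_2b_2+x_3b_3=t\}$. -}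

module Defs where

open import Axiom.UniquenessOfIdentityProofs using (module Decidable⇒UIP)
open import Data.Empty using (⊥-elim)
open import Data.Fin using (Fin; zero; suc; toℕ)
open import Data.Integer
  using (ℤ; +_; -[1+_]; 0ℤ; _+_; _*_; _≤_; _≟_; ∣_∣; Positive; +≤+)
import Data.Integer.Properties as ℤ
open import Data.List using (List; []; _∷_; length; map; filter; upTo; cartesianProduct; lookup)
open import Data.List.Membership.Propositional using (_∈_)
open import Data.List.Membership.Propositional.Properties
  using (∈-lookup; ∈-filter⁺; ∈-filter⁻; ∈-cartesianProduct⁺; ∈-cartesianProduct⁻;
         ∈-map⁺; ∈-map⁻; ∈-upTo⁺)
import Data.List.Relation.Unary.All as All
open import Data.List.Relation.Unary.AllPairs using (_∷_)
open import Data.List.Relation.Unary.Any using (index)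
open import Data.List.Relation.Unary.Any.Properties using (lookup-index)
open import Data.List.Relation.Unary.Unique.Propositional using (Unique)
open import Data.List.Relation.Unary.Unique.Propositional.Properties
  using (map⁺; cartesianProduct⁺; upTo⁺; filter⁺)
open import Data.Nat as ℕ using (ℕ; zero; suc; _>_; NonZero)
import Data.Nat.Properties as ℕ
open import Data.Product using (Σ; _×_; _,_; ∃-syntax)
open import Function using (_↔_; mk↔ₛ′)
open import Relation.Binary.PropositionalEquality
  using (_≡_; refl; sym; trans; cong; cong₂; subst)

-- ℤ[x]: the list c₀ ∷ c₁ ∷ … ∷ c_d ∷ [] stands for c₀ + c₁ x + … + c_d x^d.
-- Trailing zeros are allowed, so c_d need not be the leading coefficient.
Polynomial : Set
Polynomial = List ℤ

coeff : Polynomial → ℕ → ℤ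
coeff []       _       = 0ℤ
coeff (c ∷ cs) zero    = c
coeff (c ∷ cs) (suc k) = coeff cs k

⟦_⟧ : Polynomial → ℤ → ℤ
⟦ []     ⟧ x = 0ℤ
⟦ c ∷ cs ⟧ x = c + x * ⟦ cs ⟧ x

-- d is then the degree of f; in particular f is not the zero polynomial.
PositiveLeadingCoefficient : Polynomial → Set
PositiveLeadingCoefficient f =
  ∃[ d ] Positive (coeff f d) × (∀ k → k > d → coeff f k ≡ 0ℤ)

record IsQuasiPolynomial (f : ℕ → ℤ) : Set where
  field
    T C         : ℕ
    T-positive  : NonZero T
    C-positive  : NonZero C
    constituent : Fin T → Polynomial
    agrees      : ∀ n m (i : Fin T) → n > C → n ≡ T ℕ.* m ℕ.+ toℕ i →
                  f n ≡ ⟦ constituent i ⟧ (+ m)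

-- A property of f alone: for n > C, f determines the constituents (as
-- polynomials) once T is fixed, and changing T preserves the signs of their
-- leading coefficients.
PositiveLeadingCoefficients : ∀ {f} → IsQuasiPolynomial f → Set
PositiveLeadingCoefficients q = ∀ i → PositiveLeadingCoefficient (constituent i)
  where open IsQuasiPolynomial q

Eventually : (ℕ → Set) → Set
Eventually P = ∃[ N ] ∀ n → n > N → P n

IsSolution : (b₁ b₂ b₃ t : ℤ) → ℤ × ℤ × ℤ → Set
IsSolution b₁ b₂ b₃ t (x₁ , x₂ , x₃) =
  (0ℤ ≤ x₁ × 0ℤ ≤ x₂ × 0ℤ ≤ x₃) × x₁ * b₁ + x₂ * b₂ + x₃ * b₃ ≡ t

-- For positive bⱼ every solution has 0 ≤ xⱼ ≤ |t|, so it suffices to count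
-- inside this box; p-cardinality below shows that nothing is missed.
box : ℤ → List (ℤ × ℤ × ℤ)
box t = cartesianProduct range (cartesianProduct range range)
  where range = map +_ (upTo (suc ∣ t ∣))

solutions : (b₁ b₂ b₃ t : ℤ) → List (ℤ × ℤ × ℤ)
solutions b₁ b₂ b₃ t =
  filter (λ (x₁ , x₂ , x₃) → x₁ * b₁ + x₂ * b₂ + x₃ * b₃ ≟ t) (box t)

p : (b₁ b₂ b₃ : ℤ) → .{{Positive b₁}} → .{{Positive b₂}} → .{{Positive b₃}} → ℤ → ℕ
p b₁ b₂ b₃ t = length (solutions b₁ b₂ b₃ t)

private
  lookup-injective : ∀ {A : Set} {xs : List A} → Unique xs →
                     ∀ i j → lookup xs i ≡ lookup xs j → i ≡ j
  lookup-injective (_ ∷ _)   zero    zero    _  = refl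
  lookup-injective (x∉ ∷ _)  zero    (suc j) eq = ⊥-elim (All.lookup x∉ (∈-lookup j) eq)
  lookup-injective (x∉ ∷ _)  (suc i) zero    eq = ⊥-elim (All.lookup x∉ (∈-lookup i) (sym eq))
  lookup-injective (_ ∷ xs!) (suc i) (suc j) eq = cong suc (lookup-injective xs! i j eq)

  enumeration : ∀ {A : Set} {P : A → Set} (xs : List A) → Unique xs →
                (∀ {x} → x ∈ xs → P x) → (∀ {x} → P x → x ∈ xs) →
                (∀ {x} (u v : P x) → u ≡ v) → Σ A P ↔ Fin (length xs)
  enumeration {A} {P} xs xs! sound complete irr = mk↔ₛ′ to from to∘from from∘to
    where
    to : Σ A P → Fin (length xs)
    to (_ , px) = index (complete px)
    from : Fin (length xs) → Σ A P
    from i = lookup xs i , sound (∈-lookup i)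
    to∘from : ∀ i → to (from i) ≡ i
    to∘from i = lookup-injective xs! _ _ (sym (lookup-index (complete (sound (∈-lookup i)))))
    ext : ∀ {x y} (px : P x) (py : P y) → x ≡ y → (x , px) ≡ (y , py)
    ext px py refl = cong (_ ,_) (irr px py)
    from∘to : ∀ s → from (to s) ≡ s
    from∘to (_ , px) = ext _ _ (sym (lookup-index (complete px)))

  IsSolution-irrelevant : ∀ {b₁ b₂ b₃ t} {x} (u v : IsSolution b₁ b₂ b₃ t x) → u ≡ v
  IsSolution-irrelevant ((u₁ , u₂ , u₃) , e) ((v₁ , v₂ , v₃) , e′) =
    cong₂ _,_
      (cong₂ _,_ (ℤ.≤-irrelevant u₁ v₁) (cong₂ _,_ (ℤ.≤-irrelevant u₂ v₂) (ℤ.≤-irrelevant u₃ v₃)))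
      (Decidable⇒UIP.≡-irrelevant _≟_ e e′)

  range : ℕ → List ℤ
  range n = map +_ (upTo (suc n))

  range! : ∀ n → Unique (range n)
  range! n = map⁺ ℤ.+-injective (upTo⁺ (suc n))

  ∈-range⁻ : ∀ {n x} → x ∈ range n → 0ℤ ≤ x
  ∈-range⁻ x∈ with _ , _ , refl ← ∈-map⁻ +_ x∈ = +≤+ ℕ.z≤n

  ∈-range⁺ : ∀ {n k} → k ℕ.≤ n → + k ∈ range n
  ∈-range⁺ k≤n = ∈-map⁺ +_ (∈-upTo⁺ (ℕ.s≤s k≤n))

  combination : ∀ x₁ x₂ x₃ b₁ b₂ b₃ →
    + x₁ * + b₁ + + x₂ * + b₂ + + x₃ * + b₃ ≡ + (x₁ ℕ.* b₁ ℕ.+ x₂ ℕ.* b₂ ℕ.+ x₃ ℕ.* b₃)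
  combination x₁ x₂ x₃ b₁ b₂ b₃ =
    cong₂ _+_ (cong₂ _+_ (sym (ℤ.pos-* x₁ b₁)) (sym (ℤ.pos-* x₂ b₂))) (sym (ℤ.pos-* x₃ b₃))

p-cardinality : ∀ b₁ b₂ b₃ t .{{_ : Positive b₁}} .{{_ : Positive b₂}} .{{_ : Positive b₃}} →
                Σ (ℤ × ℤ × ℤ) (IsSolution b₁ b₂ b₃ t) ↔ Fin (p b₁ b₂ b₃ t)
p-cardinality (+ suc b₁) (+ suc b₂) (+ suc b₃) t =
  enumeration _ unique sound complete IsSolution-irrelevant
  where
  c₁ = + suc b₁
  c₂ = + suc b₂
  c₃ = + suc b₃
  P? = λ ((x₁ , x₂ , x₃) : ℤ × ℤ × ℤ) → x₁ * c₁ + x₂ * c₂ + x₃ * c₃ ≟ t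
  r = range ∣ t ∣
  unique : Unique (solutions c₁ c₂ c₃ t)
  unique = filter⁺ P?
    (cartesianProduct⁺ (range! ∣ t ∣) (cartesianProduct⁺ (range! ∣ t ∣) (range! ∣ t ∣)))
  sound : ∀ {x} → x ∈ solutions c₁ c₂ c₃ t → IsSolution c₁ c₂ c₃ t x
  sound x∈ with x∈box , eq ← ∈-filter⁻ P? {xs = box t} x∈
           with x₁∈ , x₂₃∈ ← ∈-cartesianProduct⁻ r (cartesianProduct r r) x∈box
           with x₂∈ , x₃∈ ← ∈-cartesianProduct⁻ r r x₂₃∈ =
    (∈-range⁻ x₁∈ , ∈-range⁻ x₂∈ , ∈-range⁻ x₃∈) , eq
  complete : ∀ {x} → IsSolution c₁ c₂ c₃ t x → x ∈ solutions c₁ c₂ c₃ t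
  complete {+ x₁ , + x₂ , + x₃} (_ , eq) = ∈-filter⁺ P?
    (∈-cartesianProduct⁺ (∈-range⁺ (bound x₁≤)) (∈-cartesianProduct⁺ (∈-range⁺ (bound x₂≤)) (∈-range⁺ (bound x₃≤)))) eq
    where
    y₁ = x₁ ℕ.* suc b₁
    y₂ = x₂ ℕ.* suc b₂
    y₃ = x₃ ℕ.* suc b₃
    bound : ∀ {k} → k ℕ.≤ y₁ ℕ.+ y₂ ℕ.+ y₃ → k ℕ.≤ ∣ t ∣
    bound = subst (_ ℕ.≤_)
      (cong ∣_∣ (trans (sym (combination x₁ x₂ x₃ (suc b₁) (suc b₂) (suc b₃))) eq))
    x₁≤ : x₁ ℕ.≤ y₁ ℕ.+ y₂ ℕ.+ y₃
    x₁≤ = ℕ.≤-trans (ℕ.m≤m*n x₁ (suc b₁)) (ℕ.≤-trans (ℕ.m≤m+n y₁ y₂) (ℕ.m≤m+n _ y₃))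
    x₂≤ : x₂ ℕ.≤ y₁ ℕ.+ y₂ ℕ.+ y₃
    x₂≤ = ℕ.≤-trans (ℕ.m≤m*n x₂ (suc b₂)) (ℕ.≤-trans (ℕ.m≤n+m y₂ y₁) (ℕ.m≤m+n _ y₃))
    x₃≤ : x₃ ℕ.≤ y₁ ℕ.+ y₂ ℕ.+ y₃
    x₃≤ = ℕ.≤-trans (ℕ.m≤m*n x₃ (suc b₃)) (ℕ.m≤n+m y₃ (y₁ ℕ.+ y₂))
  complete { -[1+ _ ] , _ , _} ((() , _ , _) , _)
  complete {+ _ , -[1+ _ ] , _} ((_ , () , _) , _)
  complete {+ _ , + _ , -[1+ _ ]} ((_ , _ , ()) , _)

{-# OPTIONS --safe #-}

-- Let g = gcd(a₁ , a₂) and h = gcd(g , a₃).  There is no solution unless h ∣ m; otherwise the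
-- solutions (t , x₃) of t g + x₃ a₃ = m and, for each of them, the solutions (x₁ , x₂) of
-- x₁ a₁ + x₂ a₂ = t g form arithmetic progressions given by Bézout coefficients.  Counting them
-- expresses p through sums ∑ ⌊(a z + b) / c⌋ over 0 ≤ z < n, which the reciprocity law
-- a ↔ c evaluates along the Euclidean algorithm.
--
-- Each step of the Euclidean algorithm uses only ring operations and floor division, under
-- which quasi-polynomials are closed.  On quasi-polynomial input the number of steps is
-- bounded independently of n: degrees do not increase, and while the degree stays the same
-- the leading coefficients, being nonnegative integers, decrease.  So Bézout coefficients
-- and floor sums of quasi-polynomials are quasi-polynomials.
module Submission where

open import Defs
open import Axiom.UniquenessOfIdentityProofs using (module Decidable⇒UIP)
open import Data.Empty using (⊥; ⊥-elim)
open import Data.Fin as Fin using (Fin; toℕ; fromℕ<)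
open import Data.Fin.Permutation using (↔⇒≡)
import Data.Fin.Properties as Fin
open import Data.Integer
  using (ℤ; +_; -[1+_]; +[1+_]; 0ℤ; 1ℤ; -1ℤ; _+_; _*_; _-_; -_; _≤_; _<_; +≤+; +<+;
         _/ℕ_; ∣_∣; _^_; Positive; positive)
import Data.Integer.DivMod as ℤ
import Data.Integer.Properties as ℤ
open import Data.Integer.Tactic.RingSolver using (solve-∀)
open import Data.List using ([]; _∷_)
open import Data.Nat as ℕ using (ℕ; zero; suc)
import Data.Nat.DivMod as ℕ
import Data.Nat.Properties as ℕ
import Data.Nat.Tactic.RingSolver as ℕ-Ring
open import Data.Product as Product using (Σ; Σ-syntax; _×_; _,_; proj₁; proj₂; ∃-syntax)
open import Data.Product.Function.Dependent.Propositional using (Σ-↔)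
open import Data.Sum using (_⊎_; inj₁; inj₂)
open import Data.Sum.Function.Propositional using (_⊎-↔_)
open import Function using (_∘_; _↔_; mk↔ₛ′)
open import Function.Properties.Inverse using (↔-refl; ↔-sym; ↔-trans)
open import Relation.Binary.PropositionalEquality
  using (_≡_; refl; sym; trans; cong; cong₂; subst; subst₂; module ≡-Reasoning)
open import Relation.Nullary using (¬_)

-- Floor division

-- No recursion depends on n: the Euclidean functions recurse on a step budget, so for a fixed
-- budget they are fixed expressions in ring operations and `fdiv`, and `Terminates` certifies for
-- each large n that the budget suffices. Giving `fdiv` a value on every divisor makes closure under
-- it unconditional. The obstacle is a budget that serves all large n. Floor division may force a
-- passage to residue classes n = T m + i, which multiplies the leading coefficients in degree d by
-- T^d and would spoil their descent. The descent therefore runs inside one residue class: two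
-- polynomials of the same degree have an eventually constant quotient, so the next remainder is
-- again a polynomial in the same variable. Classes are split only at the first division for each
-- degree bound, and the bound drops between two such splits.

≤-diff : ∀ {x y} → x ≤ y → 0ℤ ≤ y - x
≤-diff = ℤ.i≤j⇒0≤j-i

-- The usual route to an inequality below: the ring solver identifies the slack `y - x` with an
-- expression `e` that is visibly nonnegative.
diff-≤ : ∀ {x y e} → 0ℤ ≤ e → y - x ≡ e → x ≤ y
diff-≤ 0≤e eq = ℤ.0≤i-j⇒j≤i (subst (0ℤ ≤_) (sym eq) 0≤e)

0≤-+ : ∀ {x y} → 0ℤ ≤ x → 0ℤ ≤ y → 0ℤ ≤ x + y
0≤-+ = ℤ.+-mono-≤

0≤-* : ∀ {x y} → 0ℤ ≤ x → 0ℤ ≤ y → 0ℤ ≤ x * y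
0≤-* {+ x} {+ y} _ _ = subst (0ℤ ≤_) (ℤ.pos-* x y) (+≤+ ℕ.z≤n)

1≤⇒0≤ : ∀ {x} → 1ℤ ≤ x → 0ℤ ≤ x
1≤⇒0≤ = ℤ.≤-trans (+≤+ ℕ.z≤n)

1≤-* : ∀ {x y} → 1ℤ ≤ x → 1ℤ ≤ y → 1ℤ ≤ x * y
1≤-* {x} {y} 1≤x 1≤y = diff-≤ (0≤-+ (0≤-* (≤-diff 1≤x) (1≤⇒0≤ 1≤y)) (≤-diff 1≤y)) (eq x y)
  where
  eq : ∀ x y → x * y - 1ℤ ≡ (x - 1ℤ) * y + (y - 1ℤ)
  eq = solve-∀

sign-cases : ∀ c → 1ℤ ≤ c ⊎ c ≡ 0ℤ ⊎ 1ℤ ≤ - c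
sign-cases (+ zero) = inj₂ (inj₁ refl)
sign-cases +[1+ n ] = inj₁ (+≤+ (ℕ.s≤s ℕ.z≤n))
sign-cases -[1+ n ] = inj₂ (inj₂ (+≤+ (ℕ.s≤s ℕ.z≤n)))

1≤-⇒≱ : ∀ {x} → 0ℤ ≤ x → 1ℤ ≤ - x → ⊥
1≤-⇒≱ {+ zero} _ (+≤+ ())
1≤-⇒≱ {+[1+ n ]} _ ()

-- Total, with value 0 on a divisor c ≤ 0.
fdiv : ℤ → ℤ → ℤ
fdiv a +[1+ c ] = a /ℕ suc c
fdiv a (+ 0)    = 0ℤ
fdiv a -[1+ c ] = 0ℤ

fmod : ℤ → ℤ → ℤ
fmod a c = a - fdiv a c * c

fdiv-*≤ : ∀ a {c} → 1ℤ ≤ c → fdiv a c * c ≤ a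
fdiv-*≤ a {+[1+ c ]} _ = ℤ.[n/ℕd]*d≤n a (suc c)
fdiv-*≤ a {+ 0} (+≤+ ())

-- Together with `≤-fdiv⁻¹` this is the adjunction k ≤ ⌊a / c⌋ ⇔ k c ≤ a.
≤-fdiv : ∀ k a {c} → 1ℤ ≤ c → k * c ≤ a → k ≤ fdiv a c
≤-fdiv k a {+[1+ c ]} _ kc≤a =
  subst (k ≤_) (ℤ.pred-suc q)
    (ℤ.i<j⇒i≤pred[j] {k} {1ℤ + q} (ℤ.*-cancelʳ-<-nonNeg +[1+ c ]
      (ℤ.≤-<-trans kc≤a (ℤ.n<s[n/ℕd]*d a (suc c)))))
  where q = a /ℕ suc c
≤-fdiv k a {+ 0} (+≤+ ())

≤-fdiv⁻¹ : ∀ k a {c} → 1ℤ ≤ c → k ≤ fdiv a c → k * c ≤ a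
≤-fdiv⁻¹ k a {c@(+[1+ _ ])} 1≤c k≤ = ℤ.≤-trans (ℤ.*-monoʳ-≤-nonNeg c k≤) (fdiv-*≤ a 1≤c)
≤-fdiv⁻¹ k a {+ 0} (+≤+ ())

fmod≥0 : ∀ a {c} → 1ℤ ≤ c → 0ℤ ≤ fmod a c
fmod≥0 a 1≤c = ≤-diff (fdiv-*≤ a 1≤c)

fmod<c : ∀ a {c} → 1ℤ ≤ c → fmod a c < c
fmod<c a {c} 1≤c = ℤ.≰⇒> λ c≤r →
  ℤ.<-irrefl refl (ℤ.suc[i]≤j⇒i<j {fdiv a c}
    (≤-fdiv _ a 1≤c (diff-≤ (≤-diff c≤r) (eq a c (fdiv a c)))))
  where
  eq : ∀ a c q → a - (1ℤ + q) * c ≡ a - q * c - c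
  eq = solve-∀

<⇒+1≤ : ∀ {x y} → x < y → x + 1ℤ ≤ y
<⇒+1≤ {x} x<y = subst (_≤ _) (ℤ.+-comm 1ℤ x) (ℤ.i<j⇒suc[i]≤j x<y)

+1≤⇒< : ∀ {x y} → x + 1ℤ ≤ y → x < y
+1≤⇒< {x} x≤y = ℤ.suc[i]≤j⇒i<j (subst (_≤ _) (ℤ.+-comm x 1ℤ) x≤y)

fdiv-unique : ∀ a {c} q → 1ℤ ≤ c → 0ℤ ≤ a - q * c → a - q * c < c → fdiv a c ≡ q
fdiv-unique a {c} q 1≤c lo hi = ℤ.≤-antisym
  (ℤ.≮⇒≥ λ q<fdiv → ℤ.<-irrefl refl (ℤ.<-≤-trans hi (diff-≤
     (≤-diff (≤-fdiv⁻¹ (q + 1ℤ) a {c} 1≤c (<⇒+1≤ q<fdiv))) (eq a c q))))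
  (≤-fdiv q a 1≤c (ℤ.0≤i-j⇒j≤i lo))
  where
  eq : ∀ a c q → a - q * c - c ≡ a - (q + 1ℤ) * c
  eq = solve-∀

fdiv-+* : ∀ {c} a q → 1ℤ ≤ c → fdiv (a + q * c) c ≡ fdiv a c + q
fdiv-+* {c} a q 1≤c = fdiv-unique (a + q * c) (fdiv a c + q) 1≤c
  (subst (0ℤ ≤_) (eq a c q (fdiv a c)) (fmod≥0 a 1≤c))
  (subst (_< c) (eq a c q (fdiv a c)) (fmod<c a 1≤c))
  where
  eq : ∀ a c q d → a - d * c ≡ a + q * c - (d + q) * c
  eq = solve-∀

-- For c ≤ 0 this holds by the default value of `fdiv`; `euclidSum-0` meets divisors of every sign.
fdiv-fmod : ∀ b c → fdiv (fmod b c) c ≡ 0ℤ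
fdiv-fmod b -[1+ _ ] = refl
fdiv-fmod b (+ 0) = refl
fdiv-fmod b c@(+[1+ _ ]) = fdiv-unique (fmod b c) 0ℤ 1≤c
  (subst (0ℤ ≤_) (eq (fmod b c)) (fmod≥0 b 1≤c))
  (subst (_< c) (eq (fmod b c)) (fmod<c b 1≤c))
  where
  1≤c : 1ℤ ≤ c
  1≤c = +≤+ (ℕ.s≤s ℕ.z≤n)
  eq : ∀ x → x ≡ x - 0ℤ
  eq = solve-∀

-- Floor sums and the Euclidean algorithm

sum : ℕ → (ℕ → ℤ) → ℤ
sum zero    f = 0ℤ
sum (suc n) f = sum n f + f n

sum-cong : ∀ n {f g : ℕ → ℤ} → (∀ i → i ℕ.< n → f i ≡ g i) → sum n f ≡ sum n g
sum-cong zero    f≗g = refl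
sum-cong (suc n) f≗g =
  cong₂ _+_ (sum-cong n λ i i<n → f≗g i (ℕ.m<n⇒m<1+n i<n)) (f≗g n (ℕ.n<1+n n))

sum-zero : ∀ n → sum n (λ _ → 0ℤ) ≡ 0ℤ
sum-zero zero    = refl
sum-zero (suc n) = trans (ℤ.+-identityʳ _) (sum-zero n)

sum-suc : ∀ n f → sum (suc n) f ≡ f 0 + sum n (f ∘ suc)
sum-suc zero    f = ℤ.+-comm 0ℤ (f 0)
sum-suc (suc n) f = trans (cong (_+ f (suc n)) (sum-suc n f)) (ℤ.+-assoc (f 0) _ _)

-- Meant for `reciprocity`, where adding a column lengthens the second sum by a block of equal
-- terms.
sum-extend : ∀ {m n v} f → m ℕ.≤ n → (∀ i → m ℕ.≤ i → i ℕ.< n → f i ≡ v) →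
             sum n f ≡ sum m f + (+ n - + m) * v
sum-extend {m} {n} {v} f m≤n fi≡v with ℕ.m≤n⇒m<n∨m≡n m≤n
... | inj₂ refl = sym (eq (sum m f) (+ m) v)
  where
  eq : ∀ s m v → s + (m - m) * v ≡ s
  eq = solve-∀
sum-extend {m} {suc n} {v} f _ fi≡v | inj₁ (ℕ.s≤s m≤n) =
  trans (cong₂ _+_ (sum-extend f m≤n (λ i m≤i i<n → fi≡v i m≤i (ℕ.m<n⇒m<1+n i<n)))
                   (fi≡v n m≤n (ℕ.n<1+n n)))
        (eq (sum m f) (+ n) (+ m) v)
  where
  eq : ∀ s n m v → s + (n - m) * v + v ≡ s + (1ℤ + n - m) * v
  eq = solve-∀

floorSum : ℕ → (a b c : ℤ) → ℤ
floorSum n a b c = sum n λ z → fdiv (a * + z + b) c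

-- The sum 0 + 1 + ... + (n - 1), phrased with `fdiv` so that closure under floor division covers
-- it.
triangle : ℤ → ℤ
triangle n = fdiv (n * (n - 1ℤ)) (+ 2)

1≤2 : 1ℤ ≤ + 2
1≤2 = +≤+ (ℕ.s≤s ℕ.z≤n)

triangle-suc : ∀ n → triangle (1ℤ + n) ≡ triangle n + n
triangle-suc n = trans (cong (λ x → fdiv x (+ 2)) (eq n)) (fdiv-+* (n * (n - 1ℤ)) n 1≤2)
  where
  eq : ∀ n → (1ℤ + n) * (1ℤ + n - 1ℤ) ≡ n * (n - 1ℤ) + n * + 2
  eq = solve-∀

floorSum-mod : ∀ n a b {c} → 1ℤ ≤ c →
  floorSum n a b c ≡
  fdiv a c * triangle (+ n) + fdiv b c * + n + floorSum n (fmod a c) (fmod b c) c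
floorSum-mod zero a b {c} _ = sym (eq (fdiv a c) (fdiv b c))
  where
  eq : ∀ q r → q * 0ℤ + r * 0ℤ + 0ℤ ≡ 0ℤ
  eq = solve-∀
floorSum-mod (suc n) a b {c} 1≤c = begin
  floorSum n a b c + fdiv (a * + n + b) c
    ≡⟨ cong₂ _+_ (floorSum-mod n a b 1≤c)
         (trans (cong (λ x → fdiv x c) (split a b c q r (+ n)))
                (fdiv-+* (a′ * + n + b′) (q * + n + r) 1≤c)) ⟩
  q * triangle (+ n) + r * + n + floorSum n a′ b′ c + (fdiv (a′ * + n + b′) c + (q * + n + r))
    ≡⟨ regroup q r (+ n) (triangle (+ n)) (floorSum n a′ b′ c) (fdiv (a′ * + n + b′) c) ⟩
  q * (triangle (+ n) + + n) + r * (1ℤ + + n) + floorSum (suc n) a′ b′ c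
    ≡⟨ cong (λ t → q * t + r * + suc n + floorSum (suc n) a′ b′ c) (triangle-suc (+ n)) ⟨
  q * triangle (+ suc n) + r * + suc n + floorSum (suc n) a′ b′ c ∎
  where
  open ≡-Reasoning
  q = fdiv a c
  r = fdiv b c
  a′ = fmod a c
  b′ = fmod b c
  split : ∀ a b c q r n → a * n + b ≡ (a - q * c) * n + (b - r * c) + (q * n + r) * c
  split = solve-∀
  regroup : ∀ q r n t s d →
    q * t + r * n + s + (d + (q * n + r)) ≡ q * (t + n) + r * (1ℤ + n) + (s + d)
  regroup = solve-∀

-- The term y of the second sum is ⌈(c (y + 1) - b) / a⌉, so both sums together count the
-- lattice points of the rectangle [0, n) × [0, m).
reciprocity : ∀ n m {a b c} → 0ℤ ≤ a → 0ℤ ≤ b → b < c → 1ℤ ≤ c →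
  + m ≡ fdiv (a * + n + b) c →
  floorSum n a b c + floorSum m c (c - b + a - 1ℤ) a ≡ + n * + m
reciprocity zero m {a} {b} {c} 0≤a 0≤b b<c 1≤c m≡ = trans (cong (λ x → 0ℤ + sum x h) m≡0) (sym (ℤ.*-zeroˡ (+ m)))
  where
  h : ℕ → ℤ
  h y = fdiv (c * + y + (c - b + a - 1ℤ)) a
  eq : ∀ a b c → b ≡ a * 0ℤ + b - 0ℤ * c
  eq = solve-∀
  m≡0 : m ≡ 0
  m≡0 = ℤ.+-injective (trans m≡ (fdiv-unique (a * 0ℤ + b) 0ℤ 1≤c
         (subst (0ℤ ≤_) (eq a b c) 0≤b) (subst (_< c) (eq a b c) b<c)))
reciprocity (suc n) m {a} {b} {c} 0≤a 0≤b b<c 1≤c m≡ = begin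
  floorSum n a b c + fdiv (a * + n + b) c + sum m h
    ≡⟨ cong₂ (λ x y → floorSum n a b c + x + y) (sym l≡) (sum-extend h l≤m h≡) ⟩
  floorSum n a b c + + l + (sum l h + (+ m - + l) * (+ n + 1ℤ))
    ≡⟨ regroup₁ (floorSum n a b c) (+ l) (sum l h) (+ m) (+ n) ⟩
  (floorSum n a b c + sum l h) + (+ l + (+ m - + l) * (+ n + 1ℤ))
    ≡⟨ cong (_+ (+ l + (+ m - + l) * (+ n + 1ℤ))) (reciprocity n l 0≤a 0≤b b<c 1≤c l≡) ⟩
  + n * + l + (+ l + (+ m - + l) * (+ n + 1ℤ))
    ≡⟨ regroup₂ (+ n) (+ l) (+ m) ⟩
  + suc n * + m ∎
  where
  open ≡-Reasoning
  h : ℕ → ℤ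
  h y = fdiv (c * + y + (c - b + a - 1ℤ)) a
  regroup₁ : ∀ s l t m n → s + l + (t + (m - l) * (n + 1ℤ)) ≡ s + t + (l + (m - l) * (n + 1ℤ))
  regroup₁ = solve-∀
  regroup₂ : ∀ n l m → n * l + (l + (m - l) * (n + 1ℤ)) ≡ (1ℤ + n) * m
  regroup₂ = solve-∀
  0≤an+b : 0ℤ ≤ a * + n + b
  0≤an+b = 0≤-+ (0≤-* 0≤a (+≤+ ℕ.z≤n)) 0≤b
  -- `l` is the height that belongs to `n` in place of `suc n`. A row y with l ≤ y < m has a n + b <
  -- c (y + 1) ≤ a (n + 1) + b, so its ceiling is exactly n + 1.
  l : ℕ
  l = ∣ fdiv (a * + n + b) c ∣
  l≡ : + l ≡ fdiv (a * + n + b) c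
  l≡ = ℤ.0≤i⇒+∣i∣≡i (≤-fdiv 0ℤ _ 1≤c 0≤an+b)
  l≤m : l ℕ.≤ m
  l≤m = ℤ.drop‿+≤+ (subst (+ l ≤_) (sym m≡) (≤-fdiv (+ l) (a * + suc n + b) 1≤c
    (ℤ.≤-trans (≤-fdiv⁻¹ (+ l) (a * + n + b) 1≤c (ℤ.≤-reflexive l≡))
      (diff-≤ 0≤a (eq a b (+ n))))))
    where
    eq : ∀ a b n → a * (1ℤ + n) + b - (a * n + b) ≡ a
    eq = solve-∀
  h≡ : ∀ y → l ℕ.≤ y → y ℕ.< m → h y ≡ + n + 1ℤ
  h≡ y l≤y y<m = fdiv-unique (c * + y + (c - b + a - 1ℤ)) (+ n + 1ℤ) 1≤a
    (subst (0ℤ ≤_) (eq₁ a b c (+ n) (+ y)) (≤-diff (<⇒+1≤ above)))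
    (+1≤⇒< (diff-≤ (≤-diff below) (eq₂ a b c (+ n) (+ y))))
    where
    above : a * + n + b < + suc y * c
    above = ℤ.≰⇒> λ ≤ → ℕ.<-irrefl refl (ℕ.<-≤-trans (ℕ.s≤s l≤y)
      (ℤ.drop‿+≤+ (subst (+ suc y ≤_) (sym l≡) (≤-fdiv (+ suc y) (a * + n + b) 1≤c ≤))))
    below : + suc y * c ≤ a * + suc n + b
    below = ≤-fdiv⁻¹ (+ suc y) (a * + suc n + b) 1≤c (subst (+ suc y ≤_) m≡ (+≤+ y<m))
    eq₀ : ∀ a b n → a - 1ℤ ≡ (a * (1ℤ + n) + b) - (a * n + b + 1ℤ)
    eq₀ = solve-∀
    -- The existence of a row between `l` and `m` forces the slope to be positive; for a = 0 the
    -- block is empty.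
    1≤a : 1ℤ ≤ a
    1≤a = diff-≤ (≤-diff (ℤ.≤-trans (<⇒+1≤ above) below)) (eq₀ a b (+ n))
    eq₁ : ∀ a b c n y → (1ℤ + y) * c - (a * n + b + 1ℤ) ≡ c * y + (c - b + a - 1ℤ) - (n + 1ℤ) * a
    eq₁ = solve-∀
    eq₂ : ∀ a b c n y → a - (c * y + (c - b + a - 1ℤ) - (n + 1ℤ) * a + 1ℤ) ≡
                        (a * (1ℤ + n) + b) - (1ℤ + y) * c
    eq₂ = solve-∀

-- The index bounds the number of divisions from above, since `stop` is available at every `k`. Runs
-- of different lengths, for different n or residue classes, can thus share one index.
data Terminates : ℕ → ℤ → ℤ → Set where
  stop : ∀ {k a} → Terminates k a 0ℤ
  step : ∀ {k a c} → 1ℤ ≤ c → Terminates k c (fmod a c) → Terminates (suc k) a c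

Terminates-+ : ∀ {k a c} l → Terminates k a c → Terminates (k ℕ.+ l) a c
Terminates-+ l stop         = stop
Terminates-+ l (step 1≤c t) = step 1≤c (Terminates-+ l t)

-- One step reduces `a` and `b` modulo `c` and then replaces the remaining floor sum by `n * m`
-- minus its reciprocal one. The recursion is on the budget rather than on `c`, so that a fixed
-- budget yields a fixed expression.
euclidSum : ℕ → (n a b c : ℤ) → ℤ
euclidSum zero    n a b c = 0ℤ
euclidSum (suc k) n a b c =
  fdiv a c * triangle n + fdiv b c * n +
  (n * m - euclidSum k m c (c - fmod b c + fmod a c - 1ℤ) (fmod a c))
  where m = fdiv (fmod a c * n + fmod b c) c

-- Makes surplus budget harmless: at c = 0 the height is 0 by default, so every later call sums over
-- an empty range, whatever its other arguments are.
euclidSum-0 : ∀ k a b c → euclidSum k 0ℤ a b c ≡ 0ℤ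
euclidSum-0 zero    a b c = refl
euclidSum-0 (suc k) a b c = begin
  fdiv a c * 0ℤ + fdiv b c * 0ℤ + (0ℤ * m - euclidSum k m c b′ a′)
    ≡⟨ cong (λ x → fdiv a c * 0ℤ + fdiv b c * 0ℤ + (0ℤ - euclidSum k x c b′ a′)) m≡0 ⟩
  fdiv a c * 0ℤ + fdiv b c * 0ℤ + (0ℤ - euclidSum k 0ℤ c b′ a′)
    ≡⟨ cong (λ x → fdiv a c * 0ℤ + fdiv b c * 0ℤ + (0ℤ - x)) (euclidSum-0 k c b′ a′) ⟩
  fdiv a c * 0ℤ + fdiv b c * 0ℤ + (0ℤ - 0ℤ)
    ≡⟨ eq (fdiv a c) (fdiv b c) ⟩
  0ℤ ∎
  where
  open ≡-Reasoning
  a′ = fmod a c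
  b′ = c - fmod b c + fmod a c - 1ℤ
  m = fdiv (fmod a c * 0ℤ + fmod b c) c
  m≡0 : m ≡ 0ℤ
  m≡0 = trans (cong (λ x → fdiv x c) (eq₀ a′ (fmod b c))) (fdiv-fmod b c)
    where
    eq₀ : ∀ a b → a * 0ℤ + b ≡ b
    eq₀ = solve-∀
  eq : ∀ q r → q * 0ℤ + r * 0ℤ + (0ℤ - 0ℤ) ≡ 0ℤ
  eq = solve-∀

euclidSum-correct : ∀ {k a c} → Terminates k a c → ∀ n b →
                    euclidSum k (+ n) a b c ≡ floorSum n a b c
euclidSum-correct {zero} stop n b = sym (sum-zero n)
euclidSum-correct {suc k} {a} stop n b = begin
  0ℤ * triangle (+ n) + 0ℤ * + n + (+ n * 0ℤ - euclidSum k 0ℤ 0ℤ b′ a′)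
    ≡⟨ cong (λ x → 0ℤ * triangle (+ n) + 0ℤ * + n + (+ n * 0ℤ - x)) (euclidSum-0 k 0ℤ b′ a′) ⟩
  0ℤ * triangle (+ n) + 0ℤ * + n + (+ n * 0ℤ - 0ℤ)
    ≡⟨ eq (triangle (+ n)) (+ n) ⟩
  0ℤ
    ≡⟨ sum-zero n ⟨
  floorSum n a b 0ℤ ∎
  where
  open ≡-Reasoning
  a′ = fmod a 0ℤ
  b′ = 0ℤ - fmod b 0ℤ + fmod a 0ℤ - 1ℤ
  eq : ∀ t n → 0ℤ * t + 0ℤ * n + (n * 0ℤ - 0ℤ) ≡ 0ℤ
  eq = solve-∀
euclidSum-correct {suc k} {a} {c} (step 1≤c t) n b = begin
  d + (+ n * M - euclidSum k M c b″ a′)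
    ≡⟨ cong (λ x → d + (+ n * x - euclidSum k x c b″ a′)) (sym m≡) ⟩
  d + (+ n * + m - euclidSum k (+ m) c b″ a′)
    ≡⟨ cong (λ x → d + (+ n * + m - x)) (euclidSum-correct t m b″) ⟩
  d + (+ n * + m - floorSum m c b″ a′)
    ≡⟨ cong (λ x → d + (x - floorSum m c b″ a′))
            (reciprocity n m 0≤a′ 0≤b′ (fmod<c b 1≤c) 1≤c m≡) ⟨
  d + (floorSum n a′ b′ c + floorSum m c b″ a′ - floorSum m c b″ a′)
    ≡⟨ eq d (floorSum n a′ b′ c) (floorSum m c b″ a′) ⟩
  d + floorSum n a′ b′ c
    ≡⟨ floorSum-mod n a b 1≤c ⟨
  floorSum n a b c ∎
  where
  open ≡-Reasoning
  a′ = fmod a c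
  b′ = fmod b c
  b″ = c - b′ + a′ - 1ℤ
  d = fdiv a c * triangle (+ n) + fdiv b c * + n
  M = fdiv (a′ * + n + b′) c
  m = ∣ M ∣
  0≤a′ = fmod≥0 a 1≤c
  0≤b′ = fmod≥0 b 1≤c
  m≡ : + m ≡ M
  m≡ = ℤ.0≤i⇒+∣i∣≡i (≤-fdiv 0ℤ _ 1≤c (0≤-+ (0≤-* 0≤a′ (+≤+ ℕ.z≤n)) 0≤b′))
  eq : ∀ d x y → d + (x + y - y) ≡ d + x
  eq = solve-∀

-- fdiv c c is the indicator of 1 ≤ c: the coefficients are (1 , 0) once c = 0.
bezout₁ bezout₂ : ℕ → ℤ → ℤ → ℤ
bezout₁ zero    a c = 1ℤ
bezout₁ (suc k) a c = 1ℤ - fdiv c c + fdiv c c * bezout₂ k c (fmod a c)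
bezout₂ zero    a c = 0ℤ
bezout₂ (suc k) a c =
  fdiv c c * (bezout₁ k c (fmod a c) - fdiv a c * bezout₂ k c (fmod a c))

euclidGcd : ℕ → ℤ → ℤ → ℤ
euclidGcd k a c = bezout₁ k a c * a + bezout₂ k a c * c

fdiv-self : ∀ {c} → 1ℤ ≤ c → fdiv c c ≡ 1ℤ
fdiv-self {c} 1≤c = fdiv-unique c 1ℤ 1≤c (ℤ.≤-reflexive (eq c))
  (subst (_< c) (eq c) (+1≤⇒< 1≤c))
  where
  eq : ∀ c → 0ℤ ≡ c - 1ℤ * c
  eq = solve-∀

-- `euclidGcd` is an integer combination of `a` and `c` by definition, so being a positive common
-- divisor already makes it the gcd.
euclidGcd-spec : ∀ {k a c} → Terminates k a c → 1ℤ ≤ a → let g = euclidGcd k a c in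
                 1ℤ ≤ g × (∃[ α ] a ≡ α * g) × (∃[ γ ] c ≡ γ * g)
euclidGcd-spec {zero} {a} stop 1≤a =
  subst (1ℤ ≤_) g≡ 1≤a , (1ℤ , trans g≡ (sym (ℤ.*-identityˡ _))) , (0ℤ , refl)
  where
  eq : ∀ a → a ≡ 1ℤ * a + 0ℤ
  eq = solve-∀
  g≡ = eq a
euclidGcd-spec {suc k} {a} stop 1≤a =
  subst (1ℤ ≤_) g≡ 1≤a , (1ℤ , trans g≡ (sym (ℤ.*-identityˡ _))) , (0ℤ , refl)
  where
  eq : ∀ a x y → a ≡ (1ℤ - 0ℤ + 0ℤ * x) * a + (0ℤ * y) * 0ℤ
  eq = solve-∀
  g≡ = eq a (bezout₂ k 0ℤ (fmod a 0ℤ)) (bezout₁ k 0ℤ (fmod a 0ℤ) - 0ℤ * bezout₂ k 0ℤ (fmod a 0ℤ))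
euclidGcd-spec {suc k} {a} {c} (step 1≤c t) _
  with 1≤g , (γ , c≡) , (ρ , r≡) ← euclidGcd-spec t 1≤c =
  subst (1ℤ ≤_) g≡ 1≤g ,
  (ρ + q * γ , trans (trans (eq a c q) (trans (cong₂ (λ x y → x + q * y) r≡ c≡) (eq′ ρ γ q g′)))
                     (cong ((ρ + q * γ) *_) g≡)) ,
  (γ , trans c≡ (cong (γ *_) g≡))
  where
  q = fdiv a c
  U = bezout₁ k c (fmod a c)
  V = bezout₂ k c (fmod a c)
  g′ = euclidGcd k c (fmod a c)
  eq : ∀ a c q → a ≡ (a - q * c) + q * c
  eq = solve-∀
  eq′ : ∀ ρ γ q g → ρ * g + q * (γ * g) ≡ (ρ + q * γ) * g
  eq′ = solve-∀
  eq″ : ∀ a c q U V → U * c + V * (a - q * c) ≡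
        (1ℤ - 1ℤ + 1ℤ * V) * a + (1ℤ * (U - q * V)) * c
  eq″ = solve-∀
  g≡ : g′ ≡ euclidGcd (suc k) a c
  g≡ = trans (eq″ a c q U V)
    (cong (λ z → (1ℤ - z + z * V) * a + (z * (U - q * V)) * c) (sym (fdiv-self 1≤c)))

-- Quasi-polynomials

-- Kept abstract in `∨` because it merges thresholds and step budgets, both by addition, as well as
-- periods, by multiplication.
uniform : ∀ {A : Set} (_∨_ : A → A → A) (R : ℕ → A → Set) →
          (∀ {i a} b → R i a → R i (a ∨ b)) → (∀ {i b} a → R i b → R i (a ∨ b)) →
          A → (∀ i → ∃[ a ] R i a) → ∀ n → ∃[ a ] (∀ i → i ℕ.< n → R i a)
uniform _∨_ R monoˡ monoʳ a₀ bound zero    = a₀ , λ _ ()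
uniform _∨_ R monoˡ monoʳ a₀ bound (suc n)
  with a , Ra ← uniform _∨_ R monoˡ monoʳ a₀ bound n | b , Rb ← bound n =
  a ∨ b , λ i i<1+n → helper i (ℕ.m≤n⇒m<n∨m≡n (ℕ.s≤s⁻¹ i<1+n))
  where
  helper : ∀ i → i ℕ.< n ⊎ i ≡ n → R i (a ∨ b)
  helper i (inj₁ i<n)  = monoˡ b (Ra i i<n)
  helper i (inj₂ refl) = monoʳ a Rb

ev-all : ∀ {P : ℕ → Set} → (∀ n → P n) → Eventually P
ev-all p = 0 , λ n _ → p n

ev-map : ∀ {P Q : ℕ → Set} → (∀ n → P n → Q n) → Eventually P → Eventually Q
ev-map f (N , p) = N , λ n n>N → f n (p n n>N)

ev-zip : ∀ {P Q R : ℕ → Set} → (∀ n → P n → Q n → R n) →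
         Eventually P → Eventually Q → Eventually R
ev-zip f (M , p) (N , q) = M ℕ.+ N , λ n n>M+N →
  f n (p n (ℕ.≤-<-trans (ℕ.m≤m+n M N) n>M+N)) (q n (ℕ.≤-<-trans (ℕ.m≤n+m N M) n>M+N))

ev-× : ∀ {P Q : ℕ → Set} → Eventually P → Eventually Q → Eventually (λ n → P n × Q n)
ev-× = ev-zip λ _ → _,_

-- Large n exist, so a conclusion that does not mention n holds outright. With A = ⊥ an eventual
-- contradiction becomes an actual one.
ev-const : ∀ {A : Set} → Eventually (λ _ → A) → A
ev-const (N , p) = p (suc N) (ℕ.n<1+n N)

m≤affine : ∀ t m i → m ℕ.≤ suc t ℕ.* m ℕ.+ i
m≤affine t m i = ℕ.≤-trans (ℕ.m≤n*m m (suc t)) (ℕ.m≤m+n _ i)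

ev-affine : ∀ {P : ℕ → Set} t i → Eventually P → Eventually (λ m → P (suc t ℕ.* m ℕ.+ i))
ev-affine t i (N , p) = N , λ m m>N → p _ (ℕ.<-≤-trans m>N (m≤affine t m i))

affine-residue : ∀ t n → n ≡ suc t ℕ.* (n ℕ./ suc t) ℕ.+ n ℕ.% suc t
affine-residue t n = trans (ℕ.m≡m%n+[m/n]*n n (suc t))
  (trans (ℕ.+-comm (n ℕ.% suc t) _) (cong (ℕ._+ n ℕ.% suc t) (ℕ.*-comm (n ℕ./ suc t) (suc t))))

-- The offset `i` may exceed the period; its quotient becomes a shift of `m`. The factor 1 gives the
-- shift the shape of `ev-affine` and `EP-affine` at period 1.
residue : ∀ t i m → suc t ℕ.* m ℕ.+ i ≡ suc t ℕ.* (1 ℕ.* m ℕ.+ i ℕ./ suc t) ℕ.+ i ℕ.% suc t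
residue t i m = trans (cong (suc t ℕ.* m ℕ.+_) (affine-residue t i))
                      (eq t m (i ℕ./ suc t) (i ℕ.% suc t))
  where
  eq : ∀ t m j r → suc t ℕ.* m ℕ.+ (suc t ℕ.* j ℕ.+ r) ≡ suc t ℕ.* (1 ℕ.* m ℕ.+ j) ℕ.+ r
  eq = ℕ-Ring.solve-∀

ev-glue : ∀ {P : ℕ → Set} t → (∀ i → Eventually (λ m → P (suc t ℕ.* m ℕ.+ i))) → Eventually P
-- Beyond (t + 1)(N + 1) the quotient of n by t + 1 is at least N + 1, hence past the common
-- threshold N of the residue classes.
ev-glue {P} t branch = suc t ℕ.* suc N , λ n n> →
  subst P (sym (affine-residue t n))
    (proj₂ common (n ℕ.% suc t) (ℕ.m%n<n n (suc t)) (n ℕ./ suc t)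
      (subst (ℕ._≤ n ℕ./ suc t)
        (trans (cong (ℕ._/ suc t) (ℕ.*-comm (suc t) (suc N))) (ℕ.m*n/n≡m (suc N) (suc t)))
        (ℕ./-monoˡ-≤ (suc t) (ℕ.<⇒≤ n>))))
  where
  common : ∃[ N ] (∀ i → i ℕ.< suc t → ∀ m → m ℕ.> N → P (suc t ℕ.* m ℕ.+ i))
  common = uniform ℕ._+_ (λ i N → ∀ m → m ℕ.> N → P (suc t ℕ.* m ℕ.+ i))
    (λ {_} {M} N p m m> → p m (ℕ.≤-<-trans (ℕ.m≤m+n M N) m>))
    (λ {_} {N} M p m m> → p m (ℕ.≤-<-trans (ℕ.m≤n+m N M) m>))
    0 branch (suc t)
  N = proj₁ common

-- f agrees on ℕ with a polynomial of degree at most d whose coefficient of x^d is c.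
data Poly : ℕ → ℤ → (ℕ → ℤ) → Set where
  constant : ∀ {c f} → (∀ n → f n ≡ c) → Poly 0 c f
  horner   : ∀ {d c f} a g → Poly d c g → (∀ n → f n ≡ a + + n * g n) → Poly (suc d) c f

Poly-cong : ∀ {d c f g} → (∀ n → f n ≡ g n) → Poly d c g → Poly d c f
Poly-cong f≗g (constant g≡)     = constant λ n → trans (f≗g n) (g≡ n)
Poly-cong f≗g (horner a h p g≡) = horner a h p λ n → trans (f≗g n) (g≡ n)

Poly-+ : ∀ {d b c f g} → Poly d b f → Poly d c g → Poly d (b + c) (λ n → f n + g n)
Poly-+ (constant f≡) (constant g≡) = constant λ n → cong₂ _+_ (f≡ n) (g≡ n)
Poly-+ (horner a f′ p f≡) (horner b g′ q g≡) =
  horner (a + b) (λ n → f′ n + g′ n) (Poly-+ p q)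
    λ n → trans (cong₂ _+_ (f≡ n) (g≡ n)) (eq a b (+ n) (f′ n) (g′ n))
  where
  eq : ∀ a b n f g → (a + n * f) + (b + n * g) ≡ a + b + n * (f + g)
  eq = solve-∀

Poly-scale : ∀ {d c f} k → Poly d c f → Poly d (k * c) (λ n → k * f n)
Poly-scale k (constant f≡) = constant λ n → cong (k *_) (f≡ n)
Poly-scale k (horner a g p f≡) = horner (k * a) (λ n → k * g n) (Poly-scale k p)
  λ n → trans (cong (k *_) (f≡ n)) (eq k a (+ n) (g n))
  where
  eq : ∀ k a n g → k * (a + n * g) ≡ k * a + n * (k * g)
  eq = solve-∀

Poly-lead : ∀ {d b c f} → b ≡ c → Poly d b f → Poly d c f
Poly-lead refl p = p

Poly-minus : ∀ {d b c f g} q → Poly d b f → Poly d c g → Poly d (b - q * c) (λ n → f n - q * g n)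
Poly-minus {b = b} {c} {f} {g} q pf pg =
  Poly-lead (eq b q c) (Poly-cong (λ n → sym (eq (f n) q (g n))) (Poly-+ pf (Poly-scale (- q) pg)))
  where
  eq : ∀ b q c → b + - q * c ≡ b - q * c
  eq = solve-∀

Poly-pad : ∀ {d c f} → Poly d c f → Poly (suc d) 0ℤ f
Poly-pad {c = c} (constant f≡) =
  horner c (λ _ → 0ℤ) (constant λ _ → refl) λ n → trans (f≡ n) (eq c (+ n))
  where
  eq : ∀ c n → c ≡ c + n * 0ℤ
  eq = solve-∀
Poly-pad (horner a g p f≡) = horner a g (Poly-pad p) f≡

Poly-raise : ∀ {d c f} k → Poly d c f → ∃[ b ] Poly (k ℕ.+ d) b f
Poly-raise zero    p = _ , p
Poly-raise (suc k) p = _ , Poly-pad (proj₂ (Poly-raise k p))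

Poly-drop : ∀ {d f} → Poly (suc d) 0ℤ f → ∃[ c ] Poly d c f
Poly-drop {zero} (horner a g (constant g≡) f≡) =
  a , constant λ n → trans (f≡ n) (trans (cong (λ x → a + + n * x) (g≡ n)) (eq a (+ n)))
  where
  eq : ∀ a n → a + n * 0ℤ ≡ a
  eq = solve-∀
Poly-drop {suc d} (horner a g p f≡) with c , q ← Poly-drop p = c , horner a g q f≡

Poly-shift : ∀ {d c f} k → Poly d c f → Poly (k ℕ.+ d) c (λ n → (+ n) ^ k * f n)
Poly-shift {f = f} zero p = Poly-cong (λ n → ℤ.*-identityˡ (f n)) p
Poly-shift (suc k) p = horner 0ℤ _ (Poly-shift k p) λ n → eq (+ n) ((+ n) ^ k) _
  where
  eq : ∀ n m f → n * m * f ≡ 0ℤ + n * (m * f)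
  eq = solve-∀

Poly-affine : ∀ {d c f} t i → Poly d c f →
              Poly d (c * (+ suc t) ^ d) (λ m → f (suc t ℕ.* m ℕ.+ i))
Poly-affine {c = c} t i (constant f≡) = constant λ m → trans (f≡ _) (sym (ℤ.*-identityʳ c))
Poly-affine {suc d} {c} t i (horner a g p f≡) = Poly-lead (lead c T (T ^ d))
  (Poly-cong (λ m → trans (f≡ _) (trans
      (cong (λ x → a + x * g (suc t ℕ.* m ℕ.+ i)) (cong (_+ + i) (ℤ.pos-* (suc t) m)))
      (eq a T (+ m) (+ i) (g (suc t ℕ.* m ℕ.+ i)))))
    (Poly-+ (horner a _ (Poly-scale T p′) λ _ → refl) (Poly-pad (Poly-scale (+ i) p′))))
  where
  T = + suc t
  p′ = Poly-affine t i p
  lead : ∀ c T U → T * (c * U) + 0ℤ ≡ c * (T * U)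
  lead = solve-∀
  eq : ∀ a T m i g → a + (T * m + i) * g ≡ a + m * (T * g) + i * g
  eq = solve-∀

Poly-* : ∀ {d b f e c g} → Poly d b f → Poly e c g → Poly (d ℕ.+ e) (b * c) (λ n → f n * g n)
Poly-* {b = b} {g = g} (constant f≡) q = Poly-cong (λ n → cong (_* g n) (f≡ n)) (Poly-scale b q)
Poly-* {suc d} {b} {f} {e} {c} {g} (horner a h p f≡) q with _ , r ← Poly-raise d (Poly-scale a q) =
  Poly-lead (ℤ.+-identityʳ (b * c))
    (Poly-cong (λ n → trans (cong (_* g n) (f≡ n)) (eq a (+ n) (h n) (g n)))
      (Poly-+ (horner 0ℤ _ (Poly-* p q) λ _ → refl) (Poly-pad r)))
  where
  eq : ∀ a n h g → (a + n * h) * g ≡ 0ℤ + n * (h * g) + a * g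
  eq = solve-∀

0≤∣i∣+i : ∀ i → 0ℤ ≤ + ∣ i ∣ + i
0≤∣i∣+i (+ n)    = +≤+ ℕ.z≤n
0≤∣i∣+i -[1+ n ] = ℤ.≤-reflexive (sym (ℤ.n⊖n≡0 (suc n)))

Poly-eventually-positive : ∀ {d c f} → 1ℤ ≤ c → Poly d c f → Eventually (λ n → 1ℤ ≤ f n)
Poly-eventually-positive 1≤c (constant f≡) = ev-all λ n → subst (1ℤ ≤_) (sym (f≡ n)) 1≤c
-- By induction along the Horner form: once g n ≥ 1 and n > |a|, we get a + n g(n) ≥ a + n ≥ 1.
Poly-eventually-positive 1≤c (horner a g p f≡) =
  ev-zip (λ n n>∣a∣ 1≤g → subst (1ℤ ≤_) (sym (f≡ n))
      (diff-≤ (0≤-+ (0≤-+ (0≤∣i∣+i a) (≤-diff (+≤+ n>∣a∣)))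
                    (0≤-* (+≤+ (ℕ.z≤n {n})) (≤-diff 1≤g)))
              (eq a (+ ∣ a ∣) (+ n) (g n))))
    (∣ a ∣ , λ n n> → n>) (Poly-eventually-positive 1≤c p)
  where
  eq : ∀ a A n g → a + n * g - 1ℤ ≡ (A + a) + (n - (1ℤ + A)) + n * (g - 1ℤ)
  eq = solve-∀

Poly-eventually-negative : ∀ {d c f} → 1ℤ ≤ - c → Poly d c f → Eventually (λ n → 1ℤ ≤ - f n)
Poly-eventually-negative {c = c} {f} 1≤-c p =
  ev-map (λ n → subst (1ℤ ≤_) (ℤ.-1*i≡-i (f n)))
    (Poly-eventually-positive (subst (1ℤ ≤_) (sym (ℤ.-1*i≡-i c)) 1≤-c) (Poly-scale -1ℤ p))

Poly-lead≥0 : ∀ {d c f} → Poly d c f → Eventually (λ n → 0ℤ ≤ f n) → 0ℤ ≤ c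
Poly-lead≥0 {c = c} p f≥0 with sign-cases c
... | inj₁ 1≤c         = 1≤⇒0≤ 1≤c
... | inj₂ (inj₁ c≡0)  = ℤ.≤-reflexive (sym c≡0)
... | inj₂ (inj₂ 1≤-c) =
  ⊥-elim (ev-const (ev-zip (λ _ → 1≤-⇒≱) f≥0 (Poly-eventually-negative 1≤-c p)))

data PolySign (f : ℕ → ℤ) : Set where
  positive-lead : ∀ {d c} → 1ℤ ≤ c → Poly d c f → PolySign f
  zero-poly     : (∀ n → f n ≡ 0ℤ) → PolySign f
  negative-lead : ∀ {d c} → 1ℤ ≤ - c → Poly d c f → PolySign f

polySign : ∀ {d c f} → Poly d c f → PolySign f
polySign {d} {c} p with sign-cases c
polySign p | inj₁ 1≤c = positive-lead 1≤c p
polySign p | inj₂ (inj₂ 1≤-c) = negative-lead 1≤-c p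
polySign {zero} (constant f≡) | inj₂ (inj₁ refl) = zero-poly f≡
polySign {suc d} p | inj₂ (inj₁ refl) = polySign (proj₂ (Poly-drop p))

EventuallyPoly : (ℕ → ℤ) → Set
EventuallyPoly f = ∃[ d ] ∃[ c ] ∃[ g ] Poly d c g × Eventually (λ n → f n ≡ g n)

Poly⇒EP : ∀ {d c f} → Poly d c f → EventuallyPoly f
Poly⇒EP p = _ , _ , _ , p , ev-all λ _ → refl

EP-cong : ∀ {f g} → Eventually (λ n → f n ≡ g n) → EventuallyPoly g → EventuallyPoly f
EP-cong f≈g (_ , _ , _ , p , g≈) = _ , _ , _ , p , ev-zip (λ _ → trans) f≈g g≈

EP-affine : ∀ {f} t i → EventuallyPoly f → EventuallyPoly (λ m → f (suc t ℕ.* m ℕ.+ i))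
EP-affine t i (_ , _ , _ , p , f≈) = _ , _ , _ , Poly-affine t i p , ev-affine t i f≈

EP-const : ∀ c → EventuallyPoly (λ _ → c)
EP-const c = Poly⇒EP (constant λ _ → refl)

EP-+ : ∀ {f g} → EventuallyPoly f → EventuallyPoly g → EventuallyPoly (λ n → f n + g n)
EP-+ (d , _ , _ , p , f≈) (e , _ , g′ , q , g≈)
  with _ , p′ ← Poly-raise e p | c , q′ ← Poly-raise d q =
  _ , _ , _ , Poly-+ p′ (subst (λ k → Poly k c g′) (ℕ.+-comm d e) q′) ,
  ev-zip (λ _ → cong₂ _+_) f≈ g≈

EP-* : ∀ {f g} → EventuallyPoly f → EventuallyPoly g → EventuallyPoly (λ n → f n * g n)
EP-* (_ , _ , _ , p , f≈) (_ , _ , _ , q , g≈) = _ , _ , _ , Poly-* p q , ev-zip (λ _ → cong₂ _*_) f≈ g≈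

-- The period is suc t, and correspondingly suc (t ⊛ u) = suc t * suc u below.
Period : (ℕ → ℤ) → ℕ → Set
Period f t = ∀ i → EventuallyPoly (λ m → f (suc t ℕ.* m ℕ.+ i))

record QP (f : ℕ → ℤ) : Set where
  constructor quasi
  field
    period       : ℕ
    constituents : Period f period

infixl 7 _⊛_
_⊛_ : ℕ → ℕ → ℕ
t ⊛ u = u ℕ.+ t ℕ.* suc u

-- `Period` speaks about every offset `i`, not only those below the period. A refinement therefore
-- keeps `i` and merely rescales `m`.
period-⊛ʳ : ∀ f t u → Period f t → Period f (t ⊛ u)
period-⊛ʳ f t u p i =
  EP-cong (ev-all λ m → cong f (eq t u m i)) (EP-affine u 0 (p i))
  where
  eq : ∀ t u m i → suc (u ℕ.+ t ℕ.* suc u) ℕ.* m ℕ.+ i ≡ suc t ℕ.* (suc u ℕ.* m ℕ.+ 0) ℕ.+ i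
  eq = ℕ-Ring.solve-∀

period-⊛ˡ : ∀ f t u → Period f u → Period f (t ⊛ u)
period-⊛ˡ f t u p i =
  EP-cong (ev-all λ m → cong f (eq t u m i)) (EP-affine t 0 (p i))
  where
  eq : ∀ t u m i → suc (u ℕ.+ t ℕ.* suc u) ℕ.* m ℕ.+ i ≡ suc u ℕ.* (suc t ℕ.* m ℕ.+ 0) ℕ.+ i
  eq = ℕ-Ring.solve-∀

QP-glue : ∀ {f} t → (∀ i → QP (λ m → f (suc t ℕ.* m ℕ.+ i))) → QP f
QP-glue {f} t q = quasi (t ⊛ u) λ i → EP-cong
    (ev-all λ m → cong f (trans (cong (suc (t ⊛ u) ℕ.* m ℕ.+_) (affine-residue t i))
                                (eq t u m (i ℕ./ suc t) (i ℕ.% suc t))))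
    (proj₂ common (i ℕ.% suc t) (ℕ.m%n<n i (suc t)) (i ℕ./ suc t))
  where
  branch : ℕ → ℕ → ℤ
  branch i m = f (suc t ℕ.* m ℕ.+ i)
  common : ∃[ u ] (∀ i → i ℕ.< suc t → Period (branch i) u)
  common = uniform _⊛_ (λ i → Period (branch i))
    (λ {i} {v} w → period-⊛ʳ (branch i) v w) (λ {i} {w} v → period-⊛ˡ (branch i) v w) 0
    (λ i → QP.period (q i) , QP.constituents (q i)) (suc t)
  u = proj₁ common
  eq : ∀ t u m j r → suc (u ℕ.+ t ℕ.* suc u) ℕ.* m ℕ.+ (suc t ℕ.* j ℕ.+ r) ≡
                     suc t ℕ.* (suc u ℕ.* m ℕ.+ j) ℕ.+ r
  eq = ℕ-Ring.solve-∀

EP⇒QP : ∀ {f} → EventuallyPoly f → QP f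
EP⇒QP p = quasi 0 λ i → EP-affine 0 i p

QP-cong : ∀ {f g} → Eventually (λ n → f n ≡ g n) → QP g → QP f
QP-cong f≈g (quasi t p) = quasi t λ i → EP-cong (ev-affine t i f≈g) (p i)

-- The result of `lift` is a `QP` because `h` may create a period of its own, as floor division
-- does.
QP-lift₂ : ∀ (h : ℤ → ℤ → ℤ) →
           (∀ {f g} → EventuallyPoly f → EventuallyPoly g → QP (λ n → h (f n) (g n))) →
           ∀ {f g} → QP f → QP g → QP (λ n → h (f n) (g n))
QP-lift₂ h lift {f} {g} (quasi t p) (quasi u q) =
  QP-glue (t ⊛ u) λ i → lift (period-⊛ʳ f t u p i) (period-⊛ˡ g t u q i)

QP-const : ∀ c → QP (λ _ → c)
QP-const c = EP⇒QP (EP-const c)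

QP-+ : ∀ {f g} → QP f → QP g → QP (λ n → f n + g n)
QP-+ = QP-lift₂ _+_ λ p q → EP⇒QP (EP-+ p q)

QP-* : ∀ {f g} → QP f → QP g → QP (λ n → f n * g n)
QP-* = QP-lift₂ _*_ λ p q → EP⇒QP (EP-* p q)

QP-neg : ∀ {f} → QP f → QP (λ n → - f n)
QP-neg {f} p = QP-cong (ev-all λ n → sym (ℤ.-1*i≡-i (f n))) (QP-* (QP-const -1ℤ) p)

QP-minus : ∀ {f g} → QP f → QP g → QP (λ n → f n - g n)
QP-minus p q = QP-+ p (QP-neg q)

-- Closure under floor division

1≤-^ : ∀ {x} k → 1ℤ ≤ x → 1ℤ ≤ x ^ k
1≤-^ zero    1≤x = ℤ.≤-refl
1≤-^ (suc k) 1≤x = 1≤-* 1≤x (1≤-^ k 1≤x)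

fdiv-nonpositive : ∀ a {c} → c ≤ 0ℤ → fdiv a c ≡ 0ℤ
fdiv-nonpositive a {+ zero}   _ = refl
fdiv-nonpositive a {+[1+ _ ]} (+≤+ ())
fdiv-nonpositive a { -[1+ _ ]} _ = refl

-- With q = ⌊c / l⌋ the difference r = f - q g has leading coefficient in [0, l), so eventually -g <
-- r < g. The sign of r is eventually constant; the quotient is q if r ≥ 0 and q - 1 if r < 0.
Poly-fdiv-const : ∀ {d c l f g} → Poly d c f → Poly d l g → 1ℤ ≤ l →
                  ∃[ q ] Eventually (λ n → fdiv (f n) (g n) ≡ q)
Poly-fdiv-const {d} {c} {l} {f} {g} pf pg 1≤l = quotient (polySign r-poly)
  where
  q : ℤ
  q = fdiv c l
  r : ℕ → ℤ
  r n = f n - q * g n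
  r-poly : Poly d (fmod c l) r
  r-poly = Poly-minus q pf pg
  g≥1 : Eventually (λ n → 1ℤ ≤ g n)
  g≥1 = Poly-eventually-positive 1≤l pg
  r<g : Eventually (λ n → r n < g n)
  r<g = ev-map (λ n 1≤ → +1≤⇒< (diff-≤ (≤-diff 1≤) (eq (r n) (g n))))
    (Poly-eventually-positive
      (diff-≤ (≤-diff (<⇒+1≤ (fmod<c c 1≤l))) (eq′ (fmod c l) l))
      (Poly-minus 1ℤ pg r-poly))
    where
    eq : ∀ r g → g - (r + 1ℤ) ≡ g - 1ℤ * r - 1ℤ
    eq = solve-∀
    eq′ : ∀ r g → g - 1ℤ * r - 1ℤ ≡ g - (r + 1ℤ)
    eq′ = solve-∀
  rounds-down : Eventually (λ n → 0ℤ ≤ r n) → Eventually (λ n → fdiv (f n) (g n) ≡ q)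
  rounds-down r≥0 = ev-zip (λ n (1≤g , r<g) 0≤r → fdiv-unique (f n) q 1≤g 0≤r r<g)
    (ev-× g≥1 r<g) r≥0
  quotient : PolySign r → ∃[ q′ ] Eventually (λ n → fdiv (f n) (g n) ≡ q′)
  quotient (zero-poly r≡0)       = q , rounds-down (ev-all λ n → ℤ.≤-reflexive (sym (r≡0 n)))
  quotient (positive-lead 1≤c p) = q , rounds-down (ev-map (λ _ → 1≤⇒0≤) (Poly-eventually-positive 1≤c p))
  quotient (negative-lead 1≤-c p) = q - 1ℤ ,
    ev-zip (λ n (1≤g , 1≤r+g) 1≤-r → fdiv-unique (f n) (q - 1ℤ) 1≤g
        (diff-≤ (1≤⇒0≤ 1≤r+g) (eq₀ (f n) (g n) q))
        (+1≤⇒< (diff-≤ (≤-diff 1≤-r) (eq₁ (f n) (g n) q))))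
      (ev-× g≥1
        (Poly-eventually-positive
          (diff-≤ (0≤-+ (fmod≥0 c 1≤l) (≤-diff 1≤l)) (ℤ.+-assoc (fmod c l) l _))
          (Poly-+ r-poly pg)))
      (Poly-eventually-negative 1≤-c p)
    where
    eq₀ : ∀ f g q → f - (q - 1ℤ) * g - 0ℤ ≡ (f - q * g) + g
    eq₀ = solve-∀
    eq₁ : ∀ f g q → g - (f - (q - 1ℤ) * g + 1ℤ) ≡ - (f - q * g) - 1ℤ
    eq₁ = solve-∀

-- Substituting n = l m + i, with l the leading coefficient of g, makes the leading
-- coefficient of f divisible by that of g.
Poly-fdiv : ∀ k {d c l f g} → Poly (k ℕ.+ d) c f → Poly d l g → 1ℤ ≤ l →
            QP (λ n → fdiv (f n) (g n))
Poly-fdiv zero pf pg 1≤l with q , fdiv≡q ← Poly-fdiv-const pf pg 1≤l =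
  QP-cong fdiv≡q (QP-const q)
Poly-fdiv (suc k) {d} {c} {+ suc t} {f} {g} pf pg 1≤l = QP-glue t branch
  where
  l : ℤ
  l = + suc t
  branch : ∀ i → QP (λ m → fdiv (f (suc t ℕ.* m ℕ.+ i)) (g (suc t ℕ.* m ℕ.+ i)))
  branch i = QP-cong
      (ev-map (λ m 1≤g → trans (cong (λ x → fdiv x (g′ m)) (regroup m))
                               (fdiv-+* (r m) (s m) 1≤g))
              (Poly-eventually-positive 1≤l′ pg′))
      (QP-+ (Poly-fdiv k (proj₂ (Poly-drop pr)) pg′ 1≤l′) (EP⇒QP (EP-* (Poly⇒EP ps₁) (Poly⇒EP ps₂))))
    where
    f′ g′ s r : ℕ → ℤ
    f′ m = f (suc t ℕ.* m ℕ.+ i)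
    g′ m = g (suc t ℕ.* m ℕ.+ i)
    -- The ratio of the leading terms: after the substitution the coefficients are
    -- `c * l ^ (suc k + d)` and `l * l ^ d`. The factor `1ℤ` comes from writing the power of m as a
    -- shifted constant polynomial.
    s m = (c * l ^ k) * ((+ m) ^ suc k * 1ℤ)
    ps₁ : Poly 0 (c * l ^ k) (λ _ → c * l ^ k)
    ps₁ = constant λ _ → refl
    ps₂ : Poly (suc k ℕ.+ 0) 1ℤ (λ m → (+ m) ^ suc k * 1ℤ)
    ps₂ = Poly-shift (suc k) (constant λ _ → refl)
    pg′ : Poly d (l * l ^ d) g′
    pg′ = Poly-affine t i pg
    1≤l′ : 1ℤ ≤ l * l ^ d
    1≤l′ = 1≤-^ (suc d) 1≤l
    r m = f′ m - 1ℤ * ((+ m) ^ suc k * ((c * l ^ k) * g′ m))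
    regroup : ∀ m → f′ m ≡ r m + s m * g′ m
    regroup m = eq (f′ m) ((+ m) ^ suc k) (c * l ^ k) (g′ m)
      where
      eq : ∀ f x a g → f ≡ (f - 1ℤ * (x * (a * g))) + (a * (x * 1ℤ)) * g
      eq = solve-∀
    pr : Poly (suc k ℕ.+ d) 0ℤ r
    pr = Poly-lead lead (Poly-minus 1ℤ (Poly-affine t i pf)
           (Poly-shift (suc k) (Poly-scale (c * l ^ k) pg′)))
      where
      eq : ∀ c l x y → c * (l * (x * y)) - 1ℤ * (c * x * (l * y)) ≡ 0ℤ
      eq = solve-∀
      lead : c * l ^ (suc k ℕ.+ d) - 1ℤ * (c * l ^ k * (l * l ^ d)) ≡ 0ℤ
      lead = trans (cong (λ x → c * (l * x) - 1ℤ * (c * l ^ k * (l * l ^ d)))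
                         (ℤ.^-distribˡ-+-* l k d))
                   (eq c l (l ^ k) (l ^ d))
Poly-fdiv (suc k) {l = + zero} pf pg (+≤+ ())

EP-fdiv : ∀ {f g} → EventuallyPoly f → EventuallyPoly g → QP (λ n → fdiv (f n) (g n))
EP-fdiv {f} {g} (d , _ , f′ , pf , f≈) (_ , _ , g′ , pg , g≈) =
  QP-cong (ev-zip (λ _ → cong₂ fdiv) f≈ g≈) (by-sign (polySign pg))
  where
  zero-divisor : Eventually (λ n → g′ n ≤ 0ℤ) → QP (λ n → fdiv (f′ n) (g′ n))
  zero-divisor g≤0 = QP-cong (ev-map (λ n → fdiv-nonpositive (f′ n)) g≤0) (QP-const 0ℤ)
  by-sign : PolySign g′ → QP (λ n → fdiv (f′ n) (g′ n))
  -- Padding `f′` by the degree bound `e` of the divisor yields a bound `d + e`, so the excess is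
  -- `d` and degrees need not be compared.
  by-sign (positive-lead {e} 1≤l p) with b , q ← Poly-raise e pf =
    Poly-fdiv d (subst (λ k → Poly k b f′) (ℕ.+-comm e d) q) p 1≤l
  by-sign (zero-poly g≡0) = zero-divisor (ev-all λ n → ℤ.≤-reflexive (g≡0 n))
  by-sign (negative-lead 1≤-l p) =
    zero-divisor (ev-map (λ n 1≤-g → diff-≤ (1≤⇒0≤ 1≤-g) (ℤ.+-identityˡ (- g′ n)))
                         (Poly-eventually-negative 1≤-l p))

QP-fdiv : ∀ {f g} → QP f → QP g → QP (λ n → fdiv (f n) (g n))
QP-fdiv = QP-lift₂ fdiv EP-fdiv

QP-fmod : ∀ {f g} → QP f → QP g → QP (λ n → fmod (f n) (g n))
QP-fmod p q = QP-minus p (QP-* (QP-fdiv p q) q)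

-- Boundedness of the Euclidean algorithm

BoundedEuclid : (f g : ℕ → ℤ) → Set
BoundedEuclid f g = ∃[ k ] Eventually (λ n → Terminates k (f n) (g n))

BoundedEuclid-cong : ∀ {f f′ g g′} →
                     Eventually (λ n → f n ≡ f′ n) → Eventually (λ n → g n ≡ g′ n) →
                     BoundedEuclid f′ g′ → BoundedEuclid f g
BoundedEuclid-cong f≈ g≈ (k , e) =
  k , ev-zip (λ _ (f≡ , g≡) → subst₂ (Terminates k) (sym f≡) (sym g≡)) (ev-× f≈ g≈) e

BoundedEuclid-null : ∀ {f g} → (∀ n → g n ≡ 0ℤ) → BoundedEuclid f g
BoundedEuclid-null {f} g≡0 = 0 , ev-all λ n → subst (Terminates 0 (f n)) (sym (g≡0 n)) stop

BoundedEuclid-step : ∀ {f g} → Eventually (λ n → 1ℤ ≤ g n) →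
                     BoundedEuclid g (λ n → fmod (f n) (g n)) → BoundedEuclid f g
BoundedEuclid-step g≥1 (k , e) = suc k , ev-zip (λ _ → step) g≥1 e

BoundedEuclid-glue : ∀ {f g} t →
  (∀ i → BoundedEuclid (λ m → f (suc t ℕ.* m ℕ.+ i)) (λ m → g (suc t ℕ.* m ℕ.+ i))) →
  BoundedEuclid f g
BoundedEuclid-glue {f} {g} t b =
  k , ev-glue t λ i → ev-map (λ m → subst (λ j → Terminates k (f j) (g j)) (sym (residue t i m)))
                             (ev-affine 0 (i ℕ./ suc t) (proj₂ common (i ℕ.% suc t) (ℕ.m%n<n i (suc t))))
  where
  Branch : ℕ → ℕ → Set
  Branch i k = Eventually (λ m → Terminates k (f (suc t ℕ.* m ℕ.+ i)) (g (suc t ℕ.* m ℕ.+ i)))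
  common : ∃[ k ] (∀ i → i ℕ.< suc t → Branch i k)
  common = uniform ℕ._+_ Branch
    (λ l → ev-map λ _ → Terminates-+ l)
    (λ {i} {l} k → ev-map λ m e →
      subst (λ j → Terminates j (f (suc t ℕ.* m ℕ.+ i)) (g (suc t ℕ.* m ℕ.+ i)))
            (ℕ.+-comm l k) (Terminates-+ k e))
    0 b (suc t)
  k = proj₁ common

-- Above degree `d` no nonzero leading coefficient can occur: a positive one would eventually lift f
-- above g, a negative one would eventually push f below 0.
lower-degree : ∀ k {d c l f g} → Poly (k ℕ.+ d) c f → Poly d l g →
               Eventually (λ n → 0ℤ ≤ f n) → Eventually (λ n → f n < g n) →
               ∃[ s ] Poly d s f
lower-degree zero pf _ _ _ = _ , pf
lower-degree (suc k) {d} {c} {f = f} {g} pf pg f≥0 f<g with sign-cases c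
... | inj₁ 1≤c = ⊥-elim (ev-const (ev-zip contra f<g
        (Poly-eventually-positive (subst (1ℤ ≤_) (eq c) 1≤c)
          (Poly-minus 1ℤ pf (Poly-pad (proj₂ (Poly-raise k pg)))))))
  where
  eq : ∀ c → c ≡ c - 1ℤ * 0ℤ
  eq = solve-∀
  eq′ : ∀ f g → f - g ≡ f - 1ℤ * g - 0ℤ
  eq′ = solve-∀
  contra : ∀ n → f n < g n → 1ℤ ≤ f n - 1ℤ * g n → ⊥
  contra n f<g 1≤ = ℤ.<⇒≱ f<g (diff-≤ (≤-diff (1≤⇒0≤ 1≤)) (eq′ (f n) (g n)))
... | inj₂ (inj₁ refl) = lower-degree k (proj₂ (Poly-drop pf)) pg f≥0 f<g
... | inj₂ (inj₂ 1≤-c) =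
  ⊥-elim (ev-const (ev-zip (λ _ → 1≤-⇒≱) f≥0 (Poly-eventually-negative 1≤-c pf)))

-- The exit of `same-degree` once the divisor's coefficient at `d` vanishes. It is passed as an
-- argument, so that the induction on the degree stays outside the descent on leading coefficients.
LowerDegree : ℕ → Set
LowerDegree d = ∀ {f g} → EventuallyPoly f → Poly d 0ℤ g → Eventually (λ n → 0ℤ ≤ g n) →
                BoundedEuclid f g

-- The sum of the two leading coefficients decreases as long as the degree does not.
same-degree : ∀ {d} → LowerDegree d → ∀ w {l s g r} → Poly d l g → Poly d s r →
              Eventually (λ n → 0ℤ ≤ r n) → Eventually (λ n → r n < g n) → l + s ≤ + w →
              BoundedEuclid g r
same-degree {d} lower w {l} {s} {g} {r} pg pr r≥0 r<g l+s≤w with sign-cases s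
... | inj₂ (inj₁ refl) = lower (Poly⇒EP pg) pr r≥0
... | inj₂ (inj₂ 1≤-s) =
  ⊥-elim (ev-const (ev-zip (λ _ → 1≤-⇒≱) r≥0 (Poly-eventually-negative 1≤-s pr)))
... | inj₁ 1≤s = BoundedEuclid-step r≥1 (next w l+s≤w)
  where
  r≥1 : Eventually (λ n → 1ℤ ≤ r n)
  r≥1 = Poly-eventually-positive 1≤s pr
  0≤l : 0ℤ ≤ l
  0≤l = Poly-lead≥0 pg (ev-zip (λ _ 0≤r r<g → ℤ.≤-trans 0≤r (ℤ.<⇒≤ r<g)) r≥0 r<g)
  q : ℤ
  q = proj₁ (Poly-fdiv-const pg pr 1≤s)
  fdiv≡q : Eventually (λ n → fdiv (g n) (r n) ≡ q)
  fdiv≡q = proj₂ (Poly-fdiv-const pg pr 1≤s)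
  -- r < g makes the quotient positive. Leading coefficients (l , s) turn into (s , l - q s), and
  -- their sum drops by q s ≥ 1.
  1≤q : 1ℤ ≤ q
  1≤q = ev-const (ev-zip
    (λ n (1≤r , r<g) ≡q → subst (1ℤ ≤_) ≡q (≤-fdiv 1ℤ (g n) 1≤r
      (subst (_≤ g n) (sym (ℤ.*-identityˡ (r n))) (ℤ.<⇒≤ r<g))))
    (ev-× r≥1 r<g) fdiv≡q)
  r′ : ℕ → ℤ
  r′ n = g n - q * r n
  fmod≡ : Eventually (λ n → fmod (g n) (r n) ≡ r′ n)
  fmod≡ = ev-map (λ n ≡q → cong (λ x → g n - x * r n) ≡q) fdiv≡q
  next : ∀ w → l + s ≤ + w → BoundedEuclid r (λ n → fmod (g n) (r n))
  next zero l+s≤0 = ⊥-elim (ℤ.<⇒≱ (+1≤⇒< (ℤ.≤-trans 1≤s (diff-≤ 0≤l (eq l s)))) l+s≤0)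
    where
    eq : ∀ l s → l + s - s ≡ l
    eq = solve-∀
  next (suc w) l+s≤w = BoundedEuclid-cong (ev-all λ _ → refl) fmod≡
    (same-degree lower w pr (Poly-minus q pg pr)
      (ev-zip (λ n 1≤r ≡r′ → subst (0ℤ ≤_) ≡r′ (fmod≥0 (g n) 1≤r)) r≥1 fmod≡)
      (ev-zip (λ n 1≤r ≡r′ → subst (_< r n) ≡r′ (fmod<c (g n) 1≤r)) r≥1 fmod≡)
      (diff-≤ (0≤-+ (≤-diff l+s≤w) (≤-diff (1≤-* 1≤q 1≤s))) (eq l s q (+ w))))
    where
    eq : ∀ l s q w → w - (s + (l - q * s)) ≡ (1ℤ + w - (l + s)) + (q * s - 1ℤ)
    eq = solve-∀

-- The degree of the dividend is unrelated to `d`, but one division leaves the pair g, f mod g,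
-- whose degrees are at most `d` on each residue class; there `same-degree` takes over.
EP-Poly-boundedEuclid : ∀ d {l f g} → EventuallyPoly f → Poly d l g →
                        Eventually (λ n → 0ℤ ≤ g n) → BoundedEuclid f g
lowerDegree : ∀ d → LowerDegree d

lowerDegree zero    pf (constant g≡0) g≥0 = BoundedEuclid-null g≡0
lowerDegree (suc d) pf pg g≥0 = EP-Poly-boundedEuclid d pf (proj₂ (Poly-drop pg)) g≥0

EP-Poly-boundedEuclid d {l} {f} {g} pf pg g≥0 with sign-cases l
... | inj₂ (inj₁ refl) = lowerDegree d pf pg g≥0
... | inj₂ (inj₂ 1≤-l) =
  ⊥-elim (ev-const (ev-zip (λ _ → 1≤-⇒≱) g≥0 (Poly-eventually-negative 1≤-l pg)))
... | inj₁ 1≤l =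
  BoundedEuclid-step (Poly-eventually-positive 1≤l pg)
    (remainder (QP-fmod (EP⇒QP pf) (EP⇒QP (Poly⇒EP pg))))
  where
  remainder : QP (λ n → fmod (f n) (g n)) → BoundedEuclid g (λ n → fmod (f n) (g n))
  remainder (quasi t r-quasi) = BoundedEuclid-glue t λ i → branch i (r-quasi i)
   where
   branch : ∀ i → EventuallyPoly (λ m → fmod (f (suc t ℕ.* m ℕ.+ i)) (g (suc t ℕ.* m ℕ.+ i))) →
            BoundedEuclid (λ m → g (suc t ℕ.* m ℕ.+ i))
                          (λ m → fmod (f (suc t ℕ.* m ℕ.+ i)) (g (suc t ℕ.* m ℕ.+ i)))
   branch i (e , _ , r′ , pr , r≈) = BoundedEuclid-cong (ev-all λ _ → refl) r≈
      (same-degree (lowerDegree d) ∣ l′ + s ∣ pg′ pr′ r≥0 r<g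
        (ℤ.≤-reflexive (sym (ℤ.0≤i⇒+∣i∣≡i (0≤-+ (1≤⇒0≤ 1≤l′) (Poly-lead≥0 pr′ r≥0))))))
    where
    g′ : ℕ → ℤ
    g′ m = g (suc t ℕ.* m ℕ.+ i)
    l′ : ℤ
    l′ = l * (+ suc t) ^ d
    pg′ : Poly d l′ g′
    pg′ = Poly-affine t i pg
    1≤l′ : 1ℤ ≤ l′
    1≤l′ = 1≤-* 1≤l (1≤-^ d (+≤+ (ℕ.s≤s ℕ.z≤n)))
    g≥1 : Eventually (λ m → 1ℤ ≤ g′ m)
    g≥1 = Poly-eventually-positive 1≤l′ pg′
    r≥0 : Eventually (λ m → 0ℤ ≤ r′ m)
    r≥0 = ev-zip (λ m 1≤g ≡r → subst (0ℤ ≤_) ≡r (fmod≥0 (f (suc t ℕ.* m ℕ.+ i)) 1≤g)) g≥1 r≈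
    r<g : Eventually (λ m → r′ m < g′ m)
    r<g = ev-zip (λ m 1≤g ≡r → subst (_< g′ m) ≡r (fmod<c (f (suc t ℕ.* m ℕ.+ i)) 1≤g)) g≥1 r≈
    -- The remainder arrives with an unrelated degree bound `e`; 0 ≤ r < g brings it down to `d`.
    lowered : ∃[ s ] Poly d s r′
    lowered = lower-degree e (subst (λ k → Poly k (proj₁ (Poly-raise d pr)) r′) (ℕ.+-comm d e)
                                    (proj₂ (Poly-raise d pr))) pg′ r≥0 r<g
    s = proj₁ lowered
    pr′ = proj₂ lowered

boundedEuclid : ∀ {f g} → QP f → QP g → Eventually (λ n → 0ℤ ≤ g n) → BoundedEuclid f g
boundedEuclid {f} {g} (quasi t p) (quasi u q) g≥0 =
  BoundedEuclid-glue (t ⊛ u) λ i → branch i (period-⊛ˡ g t u q i)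
  where
  branch : ∀ i → EventuallyPoly (λ m → g (suc (t ⊛ u) ℕ.* m ℕ.+ i)) →
           BoundedEuclid (λ m → f (suc (t ⊛ u) ℕ.* m ℕ.+ i)) (λ m → g (suc (t ⊛ u) ℕ.* m ℕ.+ i))
  branch i (d , _ , g′ , pg , g≈) =
    BoundedEuclid-cong (ev-all λ _ → refl) g≈
      (EP-Poly-boundedEuclid d (period-⊛ʳ f t u p i) pg
        (ev-zip (λ m ≡g → subst (0ℤ ≤_) ≡g) g≈ (ev-affine (t ⊛ u) i g≥0)))

QP-euclidSum : ∀ k {n a b c} → QP n → QP a → QP b → QP c →
               QP (λ x → euclidSum k (n x) (a x) (b x) (c x))
QP-euclidSum zero    _ _ _ _ = QP-const 0ℤ
QP-euclidSum (suc k) n a b c =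
  QP-+ (QP-+ (QP-* (QP-fdiv a c) (QP-fdiv (QP-* n (QP-minus n (QP-const 1ℤ))) (QP-const (+ 2))))
             (QP-* (QP-fdiv b c) n))
       (QP-minus (QP-* n m) (QP-euclidSum k m c
         (QP-minus (QP-+ (QP-minus c (QP-fmod b c)) (QP-fmod a c)) (QP-const 1ℤ)) (QP-fmod a c)))
  where m = QP-fdiv (QP-+ (QP-* (QP-fmod a c) n) (QP-fmod b c)) c

QP-bezout₁ : ∀ k {a c} → QP a → QP c → QP (λ x → bezout₁ k (a x) (c x))
QP-bezout₂ : ∀ k {a c} → QP a → QP c → QP (λ x → bezout₂ k (a x) (c x))
QP-bezout₁ zero    a c = QP-const 1ℤ
QP-bezout₁ (suc k) a c =
  QP-+ (QP-minus (QP-const 1ℤ) (QP-fdiv c c)) (QP-* (QP-fdiv c c) (QP-bezout₂ k c (QP-fmod a c)))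
QP-bezout₂ zero    a c = QP-const 0ℤ
QP-bezout₂ (suc k) a c =
  QP-* (QP-fdiv c c)
       (QP-minus (QP-bezout₁ k c (QP-fmod a c)) (QP-* (QP-fdiv a c) (QP-bezout₂ k c (QP-fmod a c))))

-- Counting solutions

fdiv-* : ∀ q {c} → 1ℤ ≤ c → fdiv (q * c) c ≡ q
fdiv-* q {c} 1≤c = fdiv-unique (q * c) q 1≤c (ℤ.≤-reflexive (eq (q * c)))
  (subst (_< c) (eq (q * c)) (ℤ.<-≤-trans (+1≤⇒< ℤ.≤-refl) 1≤c))
  where
  eq : ∀ x → 0ℤ ≡ x - x
  eq = solve-∀

1≤-*-cancelʳ : ∀ x {y} → 1ℤ ≤ y → 1ℤ ≤ x * y → 1ℤ ≤ x
1≤-*-cancelʳ x {y@(+[1+ _ ])} 1≤y 1≤xy =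
  <⇒+1≤ (ℤ.*-cancelʳ-<-nonNeg {0ℤ} {x} y (+1≤⇒< {0ℤ} 1≤xy))
1≤-*-cancelʳ x {+ zero} (+≤+ ()) _


-- The cofactors are written as floors rather than as existential quotients, so that they are
-- quasi-polynomials together with `a`, `c` and `g`.
record Cofactors (a c g u v : ℤ) : Set where
  field
    1≤g    : 1ℤ ≤ g
    1≤α    : 1ℤ ≤ fdiv a g
    1≤γ    : 1ℤ ≤ fdiv c g
    a≡     : a ≡ fdiv a g * g
    c≡     : c ≡ fdiv c g * g
    bezout : u * fdiv a g + v * fdiv c g ≡ 1ℤ

euclid-cofactors : ∀ {k a c} → Terminates k a c → 1ℤ ≤ a → 1ℤ ≤ c →
                   Cofactors a c (euclidGcd k a c) (bezout₁ k a c) (bezout₂ k a c)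
euclid-cofactors {k} {a} {c} t 1≤a 1≤c = record
  { 1≤g = 1≤g
  ; 1≤α = 1≤-*-cancelʳ (fdiv a g) 1≤g (subst (1ℤ ≤_) a≡′ 1≤a)
  ; 1≤γ = 1≤-*-cancelʳ (fdiv c g) 1≤g (subst (1ℤ ≤_) c≡′ 1≤c)
  ; a≡ = a≡′
  ; c≡ = c≡′
  -- Multiplied by `g`, the left side is `u * a + v * c`, which is `g` by definition; floor division
  -- by `g` cancels the factor.
  ; bezout = trans (sym (fdiv-* (u * fdiv a g + v * fdiv c g) 1≤g))
      (trans (cong (λ x → fdiv x g) (trans (eq u v (fdiv a g) (fdiv c g) g)
                (cong₂ (λ x y → u * x + v * y) (sym a≡′) (sym c≡′))))
             (fdiv-self 1≤g))
  }
  where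
  g = euclidGcd k a c
  u = bezout₁ k a c
  v = bezout₂ k a c
  spec = euclidGcd-spec t 1≤a
  1≤g : 1ℤ ≤ g
  1≤g = proj₁ spec
  exact : ∀ {x} → ∃[ q ] x ≡ q * g → x ≡ fdiv x g * g
  exact {x} (q , x≡) = trans x≡ (cong (_* g) (sym (trans (cong (λ y → fdiv y g) x≡) (fdiv-* q 1≤g))))
  a≡′ : a ≡ fdiv a g * g
  a≡′ = exact (proj₁ (proj₂ spec))
  c≡′ : c ≡ fdiv c g * g
  c≡′ = exact (proj₂ (proj₂ spec))
  eq : ∀ u v α γ g → (u * α + v * γ) * g ≡ u * (α * g) + v * (γ * g)
  eq = solve-∀

-- Equations in two unknowns

IsSolution₂ : (b₁ b₂ t : ℤ) → ℤ × ℤ → Set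
IsSolution₂ b₁ b₂ t (x₁ , x₂) = (0ℤ ≤ x₁ × 0ℤ ≤ x₂) × x₁ * b₁ + x₂ * b₂ ≡ t

Solution₂ : (b₁ b₂ t : ℤ) → Set
Solution₂ b₁ b₂ t = Σ (ℤ × ℤ) (IsSolution₂ b₁ b₂ t)

ℤ-≡-irrelevant : ∀ {x y : ℤ} (p q : x ≡ y) → p ≡ q
ℤ-≡-irrelevant = Decidable⇒UIP.≡-irrelevant ℤ._≟_

IsSolution₂-irrelevant : ∀ {b₁ b₂ t x} (p q : IsSolution₂ b₁ b₂ t x) → p ≡ q
IsSolution₂-irrelevant ((p₁ , p₂) , e) ((q₁ , q₂) , e′) =
  cong₂ _,_ (cong₂ _,_ (ℤ.≤-irrelevant p₁ q₁) (ℤ.≤-irrelevant p₂ q₂)) (ℤ-≡-irrelevant e e′)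

Solution₂-≡ : ∀ {b₁ b₂ t x₁ x₂ y₁ y₂}
              {p : IsSolution₂ b₁ b₂ t (x₁ , x₂)} {q : IsSolution₂ b₁ b₂ t (y₁ , y₂)} →
              x₁ ≡ y₁ → x₂ ≡ y₂ → _≡_ {A = Solution₂ b₁ b₂ t} ((x₁ , x₂) , p) ((y₁ , y₂) , q)
Solution₂-≡ refl refl = cong (_ ,_) (IsSolution₂-irrelevant _ _)

-- The integer solutions of x α + y β = t are (u t + k β , v t - k α); they are nonnegative
-- for - fdiv (u t) β ≤ k ≤ fdiv (v t) α.
module TwoCoins {α β u v : ℤ} (1≤α : 1ℤ ≤ α) (1≤β : 1ℤ ≤ β) (bezout : u * α + v * β ≡ 1ℤ) where

  ways : ℤ → ℤ
  ways t = fdiv (u * t) β + fdiv (v * t) α + 1ℤ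

  -- The index is shifted so that k = 0 gives the least nonnegative x; then k is recovered as ⌊x /
  -- β⌋.
  x-coordinate : ℤ → ℤ → ℤ
  x-coordinate t k = fmod (u * t) β + k * β

  -- The floors exceed u t / β - 1 and v t / α - 1. By Bézout their sum exceeds t / (α β) - 2 ≥ -2,
  -- hence is at least -1. So the formula gives 0, never less, when there is no solution.
  ways≥0 : ∀ {t} → 0ℤ ≤ t → 0ℤ ≤ ways t
  ways≥0 {t} 0≤t = diff-≤ (≤-diff (1≤-*-cancelʳ (lo + hi + + 2) (1≤-* 1≤α 1≤β)
      (diff-≤ (0≤-+ (0≤-+ (0≤-* (≤-diff (<⇒+1≤ (fmod<c (u * t) 1≤β))) (1≤⇒0≤ 1≤α))
                          (0≤-* (≤-diff (<⇒+1≤ (fmod<c (v * t) 1≤α))) (1≤⇒0≤ 1≤β)))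
                    (0≤-+ (0≤-+ 0≤t (≤-diff 1≤α)) (1≤⇒0≤ 1≤β)))
              eq″))) (eq′ lo hi)
    where
    lo = fdiv (u * t) β
    hi = fdiv (v * t) α
    eq′ : ∀ lo hi → lo + hi + 1ℤ - 0ℤ ≡ lo + hi + + 2 - 1ℤ
    eq′ = solve-∀
    eq : ∀ α β u v t lo hi B →
      (β - (u * t - lo * β + 1ℤ)) * α + (α - (v * t - hi * α + 1ℤ)) * β + (B * t + (α - 1ℤ) + β) ≡
      ((lo + hi + + 2) * (α * β) - 1ℤ) + (B - (u * α + v * β)) * t
    eq = solve-∀
    eq₁ : ∀ x y t → x + (y - y) * t ≡ x
    eq₁ = solve-∀
    eq″ : (lo + hi + + 2) * (α * β) - 1ℤ ≡
      (β - (u * t - lo * β + 1ℤ)) * α + (α - (v * t - hi * α + 1ℤ)) * β + (t + (α - 1ℤ) + β)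
    eq″ = sym (begin
      (β - (u * t - lo * β + 1ℤ)) * α + (α - (v * t - hi * α + 1ℤ)) * β + (t + (α - 1ℤ) + β)
        ≡⟨ cong (λ x → (β - (u * t - lo * β + 1ℤ)) * α + (α - (v * t - hi * α + 1ℤ)) * β + (x + (α - 1ℤ) + β))
             (trans (sym (ℤ.*-identityˡ t)) (cong (_* t) (sym bezout))) ⟩
      (β - (u * t - lo * β + 1ℤ)) * α + (α - (v * t - hi * α + 1ℤ)) * β + ((u * α + v * β) * t + (α - 1ℤ) + β)
        ≡⟨ eq α β u v t lo hi (u * α + v * β) ⟩
      ((lo + hi + + 2) * (α * β) - 1ℤ) + ((u * α + v * β) - (u * α + v * β)) * t
        ≡⟨ eq₁ _ (u * α + v * β) t ⟩
      (lo + hi + + 2) * (α * β) - 1ℤ ∎)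
      where open ≡-Reasoning

  module _ {t : ℤ} (0≤t : 0ℤ ≤ t) where
    private
      lo hi : ℤ
      lo = fdiv (u * t) β
      hi = fdiv (v * t) α
      N : ℕ
      N = ∣ ways t ∣
      +N≡ : + N ≡ ways t
      +N≡ = ℤ.0≤i⇒+∣i∣≡i (ways≥0 0≤t)
      y-coordinate : ℤ → ℤ
      y-coordinate k = v * t - (k - lo) * α

    x≡ : ∀ {x y} → x * α + y * β ≡ t → x ≡ u * t + (x * v - u * y) * β
    x≡ {x} {y} refl = begin
      x                                             ≡⟨ ℤ.*-identityʳ x ⟨
      x * 1ℤ                                        ≡⟨ cong (x *_) bezout ⟨
      x * (u * α + v * β)                           ≡⟨ eq x y u v α β ⟩
      u * (x * α + y * β) + (x * v - u * y) * β     ∎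
      where
      open ≡-Reasoning
      eq : ∀ x y u v α β → x * (u * α + v * β) ≡ u * (x * α + y * β) + (x * v - u * y) * β
      eq = solve-∀

    y≡ : ∀ {x y} → x * α + y * β ≡ t → y ≡ v * t - (x * v - u * y) * α
    y≡ {x} {y} refl = begin
      y                                             ≡⟨ ℤ.*-identityʳ y ⟨
      y * 1ℤ                                        ≡⟨ cong (y *_) bezout ⟨
      y * (u * α + v * β)                           ≡⟨ eq x y u v α β ⟩
      v * (x * α + y * β) - (x * v - u * y) * α     ∎
      where
      open ≡-Reasoning
      eq : ∀ x y u v α β → y * (u * α + v * β) ≡ v * (x * α + y * β) - (x * v - u * y) * α
      eq = solve-∀

    fdiv-x : ∀ {x y} → x * α + y * β ≡ t → fdiv x β ≡ lo + (x * v - u * y)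
    fdiv-x {x} {y} e = trans (cong (λ z → fdiv z β) (x≡ {x} {y} e)) (fdiv-+* (u * t) (x * v - u * y) 1≤β)

    index≥0 : ∀ {x} → 0ℤ ≤ x → + ∣ fdiv x β ∣ ≡ fdiv x β
    index≥0 0≤x = ℤ.0≤i⇒+∣i∣≡i (≤-fdiv 0ℤ _ 1≤β 0≤x)

    index< : ∀ {x y} → 0ℤ ≤ x → 0ℤ ≤ y → x * α + y * β ≡ t → ∣ fdiv x β ∣ ℕ.< N
    index< {x} {y} 0≤x 0≤y e = ℤ.drop‿+<+ (subst₂ _<_ (sym (index≥0 0≤x)) (sym +N≡)
      (+1≤⇒< (diff-≤ (≤-diff (≤-fdiv (x * v - u * y) (v * t) 1≤α
                (ℤ.0≤i-j⇒j≤i (subst (0ℤ ≤_) (y≡ {x} {y} e) 0≤y))))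
              (trans (cong (λ z → ways t - (z + 1ℤ)) (fdiv-x e)) (eq lo hi (x * v - u * y))))))
      where
      eq : ∀ lo hi d → lo + hi + 1ℤ - (lo + d + 1ℤ) ≡ hi - d
      eq = solve-∀

    on-line : ∀ k → x-coordinate t k * α + y-coordinate k * β ≡ t
    on-line k = begin
      x-coordinate t k * α + y-coordinate k * β   ≡⟨ eq α β u v t lo k ⟩
      (u * α + v * β) * t                         ≡⟨ cong (_* t) bezout ⟩
      1ℤ * t                                      ≡⟨ ℤ.*-identityˡ t ⟩
      t                                           ∎
      where
      open ≡-Reasoning
      eq : ∀ α β u v t lo k → (u * t - lo * β + k * β) * α + (v * t - (k - lo) * α) * β ≡ (u * α + v * β) * t
      eq = solve-∀

    x-coordinate≥0 : ∀ k → 0ℤ ≤ x-coordinate t (+ k)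
    x-coordinate≥0 k = 0≤-+ (fmod≥0 (u * t) 1≤β) (0≤-* (+≤+ (ℕ.z≤n {k})) (1≤⇒0≤ 1≤β))

    y-coordinate≥0 : ∀ {k} → k ℕ.< N → 0ℤ ≤ y-coordinate (+ k)
    y-coordinate≥0 {k} k<N = ≤-diff (≤-fdiv⁻¹ (+ k - lo) (v * t) 1≤α
      (diff-≤ (≤-diff (<⇒+1≤ (subst (+ k <_) +N≡ (+<+ k<N)))) (eq lo hi (+ k))))
      where
      eq : ∀ lo hi k → hi - (k - lo) ≡ lo + hi + 1ℤ - (k + 1ℤ)
      eq = solve-∀

    to : Solution₂ α β t → Fin N
    to (_ , (0≤x , 0≤y) , e) = fromℕ< (index< 0≤x 0≤y e)

    from : Fin N → Solution₂ α β t
    from k = (x-coordinate t (+ toℕ k) , y-coordinate (+ toℕ k)) ,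
      (x-coordinate≥0 (toℕ k) , y-coordinate≥0 (Fin.toℕ<n k)) , on-line (+ toℕ k)

    toℕ-to : ∀ s → + toℕ (to s) ≡ fdiv (proj₁ (proj₁ s)) β
    toℕ-to (_ , (0≤x , 0≤y) , e) =
      trans (cong +_ (Fin.toℕ-fromℕ< (index< 0≤x 0≤y e))) (index≥0 0≤x)

    x-from : ∀ s → x-coordinate t (+ toℕ (to s)) ≡ proj₁ (proj₁ s)
    x-from s@((x , y) , _ , e) = begin
      fmod (u * t) β + + toℕ (to s) * β
        ≡⟨ cong (λ k → fmod (u * t) β + k * β) (trans (toℕ-to s) (fdiv-x e)) ⟩
      u * t - lo * β + (lo + (x * v - u * y)) * β
        ≡⟨ eq (u * t) lo β (x * v - u * y) ⟩
      u * t + (x * v - u * y) * β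
        ≡⟨ x≡ {x} {y} e ⟨
      x ∎
      where
      open ≡-Reasoning
      eq : ∀ ut lo β d → ut - lo * β + (lo + d) * β ≡ ut + d * β
      eq = solve-∀

    y-from : ∀ s → y-coordinate (+ toℕ (to s)) ≡ proj₂ (proj₁ s)
    y-from s@((x , y) , _ , e) = begin
      v * t - (+ toℕ (to s) - lo) * α
        ≡⟨ cong (λ k → v * t - (k - lo) * α) (trans (toℕ-to s) (fdiv-x e)) ⟩
      v * t - (lo + (x * v - u * y) - lo) * α
        ≡⟨ eq (v * t) lo α (x * v - u * y) ⟩
      v * t - (x * v - u * y) * α
        ≡⟨ y≡ {x} {y} e ⟨
      y ∎
      where
      open ≡-Reasoning
      eq : ∀ vt lo α d → vt - (lo + d - lo) * α ≡ vt - d * α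
      eq = solve-∀

    bijection : Solution₂ α β t ↔ Fin N
    bijection = mk↔ₛ′ to from
      (λ k → Fin.toℕ-injective (ℤ.+-injective (begin
        + toℕ (to (from k))                             ≡⟨ toℕ-to (from k) ⟩
        fdiv (fmod (u * t) β + + toℕ k * β) β           ≡⟨ fdiv-+* (fmod (u * t) β) (+ toℕ k) 1≤β ⟩
        fdiv (fmod (u * t) β) β + + toℕ k               ≡⟨ cong (_+ + toℕ k) (fdiv-fmod (u * t) β) ⟩
        0ℤ + + toℕ k                                    ≡⟨ ℤ.+-identityˡ _ ⟩
        + toℕ k                                         ∎)))
      (λ s → Solution₂-≡ (x-from s) (y-from s))
      where open ≡-Reasoning

-- Peels off the first term, matching the structure of `Fin (suc n)`, whereas `sum` peels off the
-- last.
sumℕ : ℕ → (ℕ → ℕ) → ℕ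
sumℕ zero    f = 0
sumℕ (suc n) f = f 0 ℕ.+ sumℕ n (f ∘ suc)

+-sumℕ : ∀ n f → + sumℕ n f ≡ sum n (λ i → + f i)
+-sumℕ zero    f = refl
+-sumℕ (suc n) f = trans (cong (λ x → + f 0 + x) (+-sumℕ n (f ∘ suc))) (sym (sum-suc n (λ i → + f i)))

Σ-Fin-suc : ∀ {n} (F : Fin (suc n) → Set) → Σ (Fin (suc n)) F ↔ (F Fin.zero ⊎ Σ (Fin n) (F ∘ Fin.suc))
Σ-Fin-suc F = mk↔ₛ′
  (λ { (Fin.zero , x) → inj₁ x ; (Fin.suc i , x) → inj₂ (i , x) })
  (λ { (inj₁ x) → Fin.zero , x ; (inj₂ (i , x)) → Fin.suc i , x })
  (λ { (inj₁ _) → refl ; (inj₂ _) → refl })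
  (λ { (Fin.zero , _) → refl ; (Fin.suc _ , _) → refl })

Σ-Fin-↔ : ∀ n f → Σ (Fin n) (λ i → Fin (f (toℕ i))) ↔ Fin (sumℕ n f)
Σ-Fin-↔ zero    f = mk↔ₛ′ (λ { (() , _) }) (λ ()) (λ ()) (λ { (() , _) })
Σ-Fin-↔ (suc n) f = ↔-trans (Σ-Fin-suc λ i → Fin (f (toℕ i)))
  (↔-trans (↔-refl ⊎-↔ Σ-Fin-↔ n (f ∘ suc)) (↔-sym Fin.+↔⊎))

-- Equations in three unknowns

Solution : (b₁ b₂ b₃ t : ℤ) → Set
Solution b₁ b₂ b₃ t = Σ (ℤ × ℤ × ℤ) (IsSolution b₁ b₂ b₃ t)

IsSolution-irrelevant : ∀ {b₁ b₂ b₃ t x} (p q : IsSolution b₁ b₂ b₃ t x) → p ≡ q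
IsSolution-irrelevant ((p₁ , p₂ , p₃) , e) ((q₁ , q₂ , q₃) , e′) =
  cong₂ _,_ (cong₂ _,_ (ℤ.≤-irrelevant p₁ q₁) (cong₂ _,_ (ℤ.≤-irrelevant p₂ q₂) (ℤ.≤-irrelevant p₃ q₃)))
            (ℤ-≡-irrelevant e e′)

p≡ : ∀ {b₁ b₂ b₃ t N} (pos₁ : Positive b₁) (pos₂ : Positive b₂) (pos₃ : Positive b₃) →
     Solution b₁ b₂ b₃ t ↔ Fin N → p b₁ b₂ b₃ {{pos₁}} {{pos₂}} {{pos₃}} t ≡ N
p≡ {b₁} {b₂} {b₃} {t} pos₁ pos₂ pos₃ bij =
  ↔⇒≡ (↔-trans (↔-sym (p-cardinality b₁ b₂ b₃ t {{pos₁}} {{pos₂}} {{pos₃}})) bij)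

p≡0 : ∀ {b₁ b₂ b₃ t} (pos₁ : Positive b₁) (pos₂ : Positive b₂) (pos₃ : Positive b₃) →
      ¬ Solution b₁ b₂ b₃ t → p b₁ b₂ b₃ {{pos₁}} {{pos₂}} {{pos₃}} t ≡ 0
p≡0 pos₁ pos₂ pos₃ none = p≡ pos₁ pos₂ pos₃
  (mk↔ₛ′ (λ s → ⊥-elim (none s)) (λ ()) (λ ()) (λ s → ⊥-elim (none s)))

-- A solution of x₁ a₁ + x₂ a₂ + x₃ a₃ = μ h amounts to a solution (t , x₃) of t γ + x₃ β = μ
-- together with a solution (x₁ , x₂) of x₁ α₁ + x₂ α₂ = t.
module ThreeCoins {a₁ a₂ a₃ α₁ α₂ γ β g h u v s w : ℤ}
  (1≤h : 1ℤ ≤ h) (1≤α₁ : 1ℤ ≤ α₁) (1≤α₂ : 1ℤ ≤ α₂) (1≤γ : 1ℤ ≤ γ) (1≤β : 1ℤ ≤ β)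
  (a₁≡ : a₁ ≡ α₁ * g) (a₂≡ : a₂ ≡ α₂ * g) (g≡ : g ≡ γ * h) (a₃≡ : a₃ ≡ β * h)
  (bezout₁₂ : u * α₁ + v * α₂ ≡ 1ℤ) (bezout₃ : s * γ + w * β ≡ 1ℤ) where

  module Inner = TwoCoins {α₁} {α₂} {u} {v} 1≤α₁ 1≤α₂ bezout₁₂
  module Outer = TwoCoins {γ} {β} {s} {w} 1≤γ 1≤β bezout₃

  combination≡ : ∀ x₁ x₂ x₃ →
    x₁ * a₁ + x₂ * a₂ + x₃ * a₃ ≡ ((x₁ * α₁ + x₂ * α₂) * γ + x₃ * β) * h
  combination≡ x₁ x₂ x₃ = begin
    x₁ * a₁ + x₂ * a₂ + x₃ * a₃
      ≡⟨ cong₂ _+_ (cong₂ (λ y z → x₁ * y + x₂ * z) (trans a₁≡ (cong (α₁ *_) g≡))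
                                                    (trans a₂≡ (cong (α₂ *_) g≡)))
                   (cong (x₃ *_) a₃≡) ⟩
    x₁ * (α₁ * (γ * h)) + x₂ * (α₂ * (γ * h)) + x₃ * (β * h)
      ≡⟨ eq x₁ x₂ x₃ α₁ α₂ γ β h ⟩
    ((x₁ * α₁ + x₂ * α₂) * γ + x₃ * β) * h ∎
    where
    open ≡-Reasoning
    eq : ∀ x₁ x₂ x₃ α₁ α₂ γ β h →
      x₁ * (α₁ * (γ * h)) + x₂ * (α₂ * (γ * h)) + x₃ * (β * h) ≡
      ((x₁ * α₁ + x₂ * α₂) * γ + x₃ * β) * h
    eq = solve-∀

  divisible : ∀ {m} → Solution a₁ a₂ a₃ m → fmod m h ≡ 0ℤ
  divisible {m} ((x₁ , x₂ , x₃) , _ , e) = begin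
    fmod m h                         ≡⟨ cong (λ x → fmod x h) (trans (sym e) (combination≡ x₁ x₂ x₃)) ⟩
    q * h - fdiv (q * h) h * h       ≡⟨ cong (λ x → q * h - x * h) (fdiv-* q 1≤h) ⟩
    q * h - q * h                    ≡⟨ ℤ.+-inverseʳ (q * h) ⟩
    0ℤ                               ∎
    where
    open ≡-Reasoning
    q = (x₁ * α₁ + x₂ * α₂) * γ + x₃ * β

  module _ {μ : ℤ} (0≤μ : 0ℤ ≤ μ) where

    Nested : Set
    Nested = Σ (Solution₂ γ β μ) λ ((t , _) , _) → Solution₂ α₁ α₂ t

    nest : Solution a₁ a₂ a₃ (μ * h) → Nested
    nest ((x₁ , x₂ , x₃) , (0≤x₁ , 0≤x₂ , 0≤x₃) , e) =
      ((x₁ * α₁ + x₂ * α₂ , x₃) ,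
       (0≤-+ (0≤-* 0≤x₁ (1≤⇒0≤ 1≤α₁)) (0≤-* 0≤x₂ (1≤⇒0≤ 1≤α₂)) , 0≤x₃) ,
       (begin
          q                ≡⟨ fdiv-* q 1≤h ⟨
          fdiv (q * h) h   ≡⟨ cong (λ x → fdiv x h) (trans (sym (combination≡ x₁ x₂ x₃)) e) ⟩
          fdiv (μ * h) h   ≡⟨ fdiv-* μ 1≤h ⟩
          μ                ∎)) ,
      ((x₁ , x₂) , (0≤x₁ , 0≤x₂) , refl)
      where
      open ≡-Reasoning
      q = (x₁ * α₁ + x₂ * α₂) * γ + x₃ * β

    flatten : Nested → Solution a₁ a₂ a₃ (μ * h)
    flatten (((t , x₃) , (_ , 0≤x₃) , e) , ((x₁ , x₂) , (0≤x₁ , 0≤x₂) , e′)) =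
      (x₁ , x₂ , x₃) , (0≤x₁ , 0≤x₂ , 0≤x₃) ,
      trans (combination≡ x₁ x₂ x₃) (cong (_* h) (trans (cong (λ x → x * γ + x₃ * β) e′) e))

    nest∘flatten : ∀ n → nest (flatten n) ≡ n
    -- Matching the inner equation with `refl` turns t into `x₁ * α₁ + x₂ * α₂` itself, so no
    -- transport along t is left.
    nest∘flatten (((_ , x₃) , i) , ((x₁ , x₂) , (0≤x₁ , 0≤x₂) , refl)) =
      cong (λ i → ((_ , x₃) , i) , ((x₁ , x₂) , (0≤x₁ , 0≤x₂) , refl)) (IsSolution₂-irrelevant _ i)

    Solution↔Nested : Solution a₁ a₂ a₃ (μ * h) ↔ Nested
    Solution↔Nested = mk↔ₛ′ nest flatten nest∘flatten
      λ (x , i) → cong (x ,_) (IsSolution-irrelevant _ i)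

    outerCount : ℕ
    outerCount = ∣ Outer.ways μ ∣

    innerCount : ℕ → ℕ
    innerCount k = ∣ Inner.ways (Outer.x-coordinate μ (+ k)) ∣

    Nested↔Fin : Nested ↔ Fin (sumℕ outerCount innerCount)
    Nested↔Fin = ↔-trans (Σ-↔ (Outer.bijection 0≤μ) (λ {s} → inner s)) (Σ-Fin-↔ outerCount innerCount)
      where
      inner : ∀ (s@((t , _) , _) : Solution₂ γ β μ) →
              Solution₂ α₁ α₂ t ↔ Fin (innerCount (toℕ (Outer.to 0≤μ s)))
      inner s@(_ , (0≤t , _) , _) =
        subst (λ t′ → _ ↔ Fin ∣ Inner.ways t′ ∣) (sym (Outer.x-from 0≤μ s)) (Inner.bijection 0≤t)

    -- The outer solution of index k has t = T + k β with T = `fmod (s * μ) β`. Both floors in the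
    -- inner count are thus of affine functions of k, and summing over k produces two floor sums.
    total : ℤ
    total = floorSum outerCount (u * β) (u * fmod (s * μ) β) α₂ +
            floorSum outerCount (v * β) (v * fmod (s * μ) β) α₁ + + outerCount

    sum≡total : + sumℕ outerCount innerCount ≡ total
    sum≡total = trans (+-sumℕ outerCount innerCount) (partial outerCount)
      where
      T = fmod (s * μ) β
      eq : ∀ u T k β → u * (T + k * β) ≡ u * β * k + u * T
      eq = solve-∀
      regroup : ∀ x y n d e → x + y + n + (d + e + 1ℤ) ≡ (x + d) + (y + e) + (1ℤ + n)
      regroup = solve-∀
      term : ∀ k → + innerCount k ≡
             fdiv (u * β * + k + u * T) α₂ + fdiv (v * β * + k + v * T) α₁ + 1ℤ
      term k = trans (ℤ.0≤i⇒+∣i∣≡i (Inner.ways≥0 (Outer.x-coordinate≥0 0≤μ k)))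
        (cong₂ (λ x y → fdiv x α₂ + fdiv y α₁ + 1ℤ) (eq u T (+ k) β) (eq v T (+ k) β))
      partial : ∀ n → sum n (λ k → + innerCount k) ≡
                floorSum n (u * β) (u * T) α₂ + floorSum n (v * β) (v * T) α₁ + + n
      partial zero    = refl
      partial (suc n) = trans (cong₂ _+_ (partial n) (term n))
        (regroup (floorSum n (u * β) (u * T) α₂) (floorSum n (v * β) (v * T) α₁) (+ n)
                 (fdiv (u * β * + n + u * T) α₂) (fdiv (v * β * + n + v * T) α₁))

    p≡total : ∀ {m} → m ≡ μ * h →
              (pos₁ : Positive a₁) (pos₂ : Positive a₂) (pos₃ : Positive a₃) →
              + p a₁ a₂ a₃ {{pos₁}} {{pos₂}} {{pos₃}} m ≡ total
    p≡total refl pos₁ pos₂ pos₃ =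
      trans (cong +_ (p≡ pos₁ pos₂ pos₃ (↔-trans Solution↔Nested Nested↔Fin))) sum≡total

-- For 1 ≤ h the remainder r lies in [0, h), so ⌊-r / h⌋ is 0 if r = 0 and -1 otherwise. An
-- arithmetic expression replaces the case distinction, which keeps the count visibly
-- quasi-polynomial.
divisibilityIndicator : ℤ → ℤ → ℤ
divisibilityIndicator m h = 1ℤ + fdiv (- fmod m h) h

divisibilityIndicator-0 : ∀ m h → fmod m h ≡ 0ℤ → 1ℤ ≤ h → divisibilityIndicator m h ≡ 1ℤ
divisibilityIndicator-0 m h r≡0 1≤h =
  trans (cong (λ r → 1ℤ + fdiv (- r) h) r≡0) (cong (λ x → 1ℤ + x) (fdiv-* 0ℤ 1≤h))

divisibilityIndicator-1≤ : ∀ m h → 1ℤ ≤ fmod m h → 1ℤ ≤ h → divisibilityIndicator m h ≡ 0ℤ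
divisibilityIndicator-1≤ m h 1≤r 1≤h = cong (λ x → 1ℤ + x) (fdiv-unique (- fmod m h) -1ℤ 1≤h
  (diff-≤ (≤-diff (ℤ.<⇒≤ (fmod<c m 1≤h))) (eq (fmod m h) h))
  (+1≤⇒< (diff-≤ (≤-diff 1≤r) (eq′ (fmod m h) h))))
  where
  eq : ∀ r h → - r - -1ℤ * h - 0ℤ ≡ h - r
  eq = solve-∀
  eq′ : ∀ r h → h - (- r - -1ℤ * h + 1ℤ) ≡ r - 1ℤ
  eq′ = solve-∀

-- The parameters `k` and `l` are the budgets of the two gcd computations, `i` and `j` those of the
-- two floor sums.
module Count (k l i j : ℕ) (a₁ a₂ a₃ m : ℤ) where

  g u v α₁ α₂ h s w γ β μ T Z count : ℤ
  g  = euclidGcd k a₁ a₂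
  u  = bezout₁ k a₁ a₂
  v  = bezout₂ k a₁ a₂
  α₁ = fdiv a₁ g
  α₂ = fdiv a₂ g
  h  = euclidGcd l g a₃
  s  = bezout₁ l g a₃
  w  = bezout₂ l g a₃
  γ  = fdiv g h
  β  = fdiv a₃ h
  μ  = fdiv m h
  T  = fmod (s * μ) β
  Z  = fdiv (s * μ) β + fdiv (w * μ) γ + 1ℤ
  count = divisibilityIndicator m h *
          (euclidSum i Z (u * β) (u * T) α₂ + euclidSum j Z (v * β) (v * T) α₁ + Z)

  count-correct :
    Terminates k a₁ a₂ → Terminates l g a₃ →
    Terminates i (u * β) α₂ → Terminates j (v * β) α₁ →
    1ℤ ≤ a₁ → 1ℤ ≤ a₂ → 1ℤ ≤ a₃ → 0ℤ ≤ m →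
    (pos₁ : Positive a₁) (pos₂ : Positive a₂) (pos₃ : Positive a₃) →
    + p a₁ a₂ a₃ {{pos₁}} {{pos₂}} {{pos₃}} m ≡ count
  count-correct tk tl ti tj 1≤a₁ 1≤a₂ 1≤a₃ 0≤m pos₁ pos₂ pos₃ = by-remainder (sign-cases (fmod m h))
    where
    module C₁ = Cofactors (euclid-cofactors tk 1≤a₁ 1≤a₂)
    module C₂ = Cofactors (euclid-cofactors tl C₁.1≤g 1≤a₃)
    module Coins = ThreeCoins {u = u} {v} {s} {w} C₂.1≤g C₁.1≤α C₁.1≤γ C₂.1≤α C₂.1≤γ C₁.a≡ C₁.c≡ C₂.a≡ C₂.c≡
                              C₁.bezout C₂.bezout
    rest : ℤ
    rest = euclidSum i Z (u * β) (u * T) α₂ + euclidSum j Z (v * β) (v * T) α₁ + Z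
    0≤μ : 0ℤ ≤ μ
    0≤μ = ≤-fdiv 0ℤ m C₂.1≤g 0≤m
    z : ℕ
    z = ∣ Z ∣
    z≡ : + z ≡ Z
    z≡ = ℤ.0≤i⇒+∣i∣≡i (Coins.Outer.ways≥0 0≤μ)
    total≡rest : Coins.total 0≤μ ≡ rest
    total≡rest = begin
      floorSum z (u * β) (u * T) α₂ + floorSum z (v * β) (v * T) α₁ + + z
        ≡⟨ cong₂ (λ x y → x + y + + z) (euclidSum-correct ti z (u * T)) (euclidSum-correct tj z (v * T)) ⟨
      euclidSum i (+ z) (u * β) (u * T) α₂ + euclidSum j (+ z) (v * β) (v * T) α₁ + + z
        ≡⟨ cong (λ x → euclidSum i x (u * β) (u * T) α₂ + euclidSum j x (v * β) (v * T) α₁ + x) z≡ ⟩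
      rest ∎
      where open ≡-Reasoning
    by-remainder : 1ℤ ≤ fmod m h ⊎ fmod m h ≡ 0ℤ ⊎ 1ℤ ≤ - fmod m h →
                   + p a₁ a₂ a₃ {{pos₁}} {{pos₂}} {{pos₃}} m ≡ count
    by-remainder (inj₁ 1≤r) = begin
      + p a₁ a₂ a₃ {{pos₁}} {{pos₂}} {{pos₃}} m
        ≡⟨ cong +_ (p≡0 {t = m} pos₁ pos₂ pos₃ λ σ → ℤ.<⇒≱ (+1≤⇒< 1≤r) (ℤ.≤-reflexive (Coins.divisible {m} σ))) ⟩
      0ℤ
        ≡⟨ cong (_* rest) (divisibilityIndicator-1≤ m h 1≤r C₂.1≤g) ⟨
      count ∎
      where open ≡-Reasoning
    by-remainder (inj₂ (inj₂ 1≤-r)) = ⊥-elim (1≤-⇒≱ (fmod≥0 m C₂.1≤g) 1≤-r)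
    by-remainder (inj₂ (inj₁ r≡0)) = begin
      + p a₁ a₂ a₃ {{pos₁}} {{pos₂}} {{pos₃}} m
        ≡⟨ Coins.p≡total 0≤μ (ℤ.i-j≡0⇒i≡j m (μ * h) r≡0) pos₁ pos₂ pos₃ ⟩
      Coins.total 0≤μ
        ≡⟨ total≡rest ⟩
      rest
        ≡⟨ ℤ.*-identityˡ rest ⟨
      1ℤ * rest
        ≡⟨ cong (_* rest) (divisibilityIndicator-0 m h r≡0 C₂.1≤g) ⟨
      count ∎
      where open ≡-Reasoning

-- Passing between IsQuasiPolynomial and QP

⟦⟧-zero : ∀ cs x → (∀ k → coeff cs k ≡ 0ℤ) → ⟦ cs ⟧ x ≡ 0ℤ
⟦⟧-zero []       x null = refl
⟦⟧-zero (c ∷ cs) x null = trans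
  (cong₂ (λ a y → a + x * y) (null 0) (⟦⟧-zero cs x (null ∘ suc)))
  (trans (ℤ.+-identityˡ (x * 0ℤ)) (ℤ.*-zeroʳ x))

Poly-zero : ∀ d → Poly d 0ℤ (λ _ → 0ℤ)
Poly-zero zero    = constant λ _ → refl
Poly-zero (suc d) = Poly-pad (Poly-zero d)

⟦⟧-Poly : ∀ cs d → (∀ k → k ℕ.> d → coeff cs k ≡ 0ℤ) → Poly d (coeff cs d) (λ n → ⟦ cs ⟧ (+ n))
⟦⟧-Poly []       d       null = Poly-zero d
⟦⟧-Poly (c ∷ cs) zero    null = constant λ n → trans
  (cong (λ y → c + + n * y) (⟦⟧-zero cs (+ n) λ k → null (suc k) (ℕ.s≤s ℕ.z≤n)))
  (trans (cong (λ x → c + x) (ℤ.*-zeroʳ (+ n))) (ℤ.+-identityʳ c))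
⟦⟧-Poly (c ∷ cs) (suc d) null =
  horner c _ (⟦⟧-Poly cs d λ k k>d → null (suc k) (ℕ.s≤s k>d)) λ _ → refl

EP-⟦⟧ : ∀ cs → EventuallyPoly (λ n → ⟦ cs ⟧ (+ n))
EP-⟦⟧ []       = EP-const 0ℤ
EP-⟦⟧ (c ∷ cs) = EP-+ (EP-const c) (EP-* (Poly⇒EP (horner 0ℤ _ (constant λ _ → refl) eq)) (EP-⟦⟧ cs))
  where
  eq : ∀ n → + n ≡ 0ℤ + + n * 1ℤ
  eq n = sym (trans (ℤ.+-identityˡ (+ n * 1ℤ)) (ℤ.*-identityʳ (+ n)))

Poly⇒Polynomial : ∀ {d c f} → Poly d c f → ∃[ cs ] (∀ n → f n ≡ ⟦ cs ⟧ (+ n))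
Poly⇒Polynomial {c = c} (constant f≡) = c ∷ [] , λ n →
  trans (f≡ n) (sym (trans (cong (λ x → c + x) (ℤ.*-zeroʳ (+ n))) (ℤ.+-identityʳ c)))
Poly⇒Polynomial (horner a g p f≡) with cs , g≡ ← Poly⇒Polynomial p =
  a ∷ cs , λ n → trans (f≡ n) (cong (λ y → a + + n * y) (g≡ n))

agrees-on-residue : ∀ {f C} t (cs : Fin (suc t) → Polynomial) →
  (∀ n m i → n ℕ.> C → n ≡ suc t ℕ.* m ℕ.+ toℕ i → f n ≡ ⟦ cs i ⟧ (+ m)) →
  ∀ i → Eventually (λ m → f (suc t ℕ.* m ℕ.+ i) ≡ ⟦ cs (i ℕ.mod suc t) ⟧ (+ (1 ℕ.* m ℕ.+ i ℕ./ suc t)))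
agrees-on-residue {f} {C} t cs agrees i = C , λ m m>C →
  trans (cong f (residue t i m)) (agrees _ _ (i ℕ.mod suc t)
    (subst (ℕ._> C) (residue t i m) (ℕ.<-≤-trans m>C (m≤affine t m i)))
    (cong (suc t ℕ.* (1 ℕ.* m ℕ.+ i ℕ./ suc t) ℕ.+_) (sym (Fin.toℕ-fromℕ< (ℕ.m%n<n i (suc t))))))

IsQuasiPolynomial⇒QP : ∀ {f} → IsQuasiPolynomial f → QP f
IsQuasiPolynomial⇒QP record { T = suc t ; constituent = cs ; agrees = agrees } =
  quasi t λ i → EP-cong (agrees-on-residue t cs agrees i)
                        (EP-affine 0 (i ℕ./ suc t) (EP-⟦⟧ (cs (i ℕ.mod suc t))))

eventually-positive : ∀ {f} (q : IsQuasiPolynomial f) → PositiveLeadingCoefficients q →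
                      Eventually (λ n → 1ℤ ≤ f n)
eventually-positive record { T = suc t ; constituent = cs ; agrees = agrees } lead =
  ev-glue t λ i → ev-zip (λ _ f≡ 1≤ → subst (1ℤ ≤_) (sym f≡) 1≤)
    (agrees-on-residue t cs agrees i)
    (ev-affine 0 (i ℕ./ suc t) (positive-constituent (i ℕ.mod suc t)))
  where
  positive-constituent : ∀ i → Eventually (λ m → 1ℤ ≤ ⟦ cs i ⟧ (+ m))
  positive-constituent i with d , pos , null ← lead i =
    Poly-eventually-positive (<⇒+1≤ {0ℤ} (ℤ.positive⁻¹ (coeff (cs i) d) {{pos}})) (⟦⟧-Poly (cs i) d null)

QP⇒IsQuasiPolynomial : ∀ {f} → QP f → IsQuasiPolynomial f
QP⇒IsQuasiPolynomial {f} (quasi t p) = record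
  { T = suc t
  -- From n > (t + 1)(N + 1) and n < (t + 1)(m + 1) it follows that m > N, the threshold shared by
  -- all constituents.
  ; C = suc t ℕ.* suc N
  ; T-positive = _
  ; C-positive = _
  ; constituent = λ i → poly (toℕ i)
  ; agrees = λ { _ m i n>C refl → proj₂ common (toℕ i) (Fin.toℕ<n i) m (ℕ.s<s⁻¹
      (ℕ.*-cancelˡ-< (suc t) (suc N) (suc m) (ℕ.<-trans n>C (subst (suc t ℕ.* m ℕ.+ toℕ i ℕ.<_)
        (trans (ℕ.+-comm (suc t ℕ.* m) (suc t)) (sym (ℕ.*-suc (suc t) m)))
        (ℕ.+-monoʳ-< (suc t ℕ.* m) (Fin.toℕ<n i)))))) }
  }
  where
  polynomial : ∀ {g} → EventuallyPoly g → ∃[ cs ] Eventually (λ m → g m ≡ ⟦ cs ⟧ (+ m))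
  polynomial (_ , _ , _ , q , g≈) with cs , ≡cs ← Poly⇒Polynomial q =
    cs , ev-map (λ m g≡ → trans g≡ (≡cs m)) g≈
  poly : ℕ → Polynomial
  poly i = proj₁ (polynomial (p i))
  common : ∃[ N ] (∀ i → i ℕ.< suc t → ∀ m → m ℕ.> N → f (suc t ℕ.* m ℕ.+ i) ≡ ⟦ poly i ⟧ (+ m))
  common = uniform ℕ._+_ (λ i N → ∀ m → m ℕ.> N → f (suc t ℕ.* m ℕ.+ i) ≡ ⟦ poly i ⟧ (+ m))
    (λ {_} {M} N e m m> → e m (ℕ.≤-<-trans (ℕ.m≤m+n M N) m>))
    (λ {_} {N} M e m m> → e m (ℕ.≤-<-trans (ℕ.m≤n+m N M) m>))
    0 (λ i → proj₂ (polynomial (p i))) (suc t)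
  N = proj₁ common

-- The number of solutions as a quasi-polynomial

QP-euclidGcd : ∀ k {a c} → QP a → QP c → QP (λ n → euclidGcd k (a n) (c n))
QP-euclidGcd k a c = QP-+ (QP-* (QP-bezout₁ k a c) a) (QP-* (QP-bezout₂ k a c) c)

-- `p` requires positivity proofs, which exist only for large n; they are therefore part of the
-- eventual statement.
CountsEventually : (a₁ a₂ a₃ m g : ℕ → ℤ) → Set
CountsEventually a₁ a₂ a₃ m g = Eventually λ n →
  Σ[ pos₁ ∈ Positive (a₁ n) ] Σ[ pos₂ ∈ Positive (a₂ n) ] Σ[ pos₃ ∈ Positive (a₃ n) ]
    + p (a₁ n) (a₂ n) (a₃ n) {{pos₁}} {{pos₂}} {{pos₃}} (m n) ≡ g n

QP-count : ∀ k l i j {a₁ a₂ a₃ m} → QP a₁ → QP a₂ → QP a₃ → QP m →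
           QP (λ n → Count.count k l i j (a₁ n) (a₂ n) (a₃ n) (m n))
QP-count k l i j A₁ A₂ A₃ M =
  QP-* (QP-+ (QP-const 1ℤ) (QP-fdiv (QP-neg (QP-fmod M H)) H))
    (QP-+ (QP-+ (QP-euclidSum i Z (QP-* U B) (QP-* U T) (QP-fdiv A₂ G))
                (QP-euclidSum j Z (QP-* V B) (QP-* V T) (QP-fdiv A₁ G))) Z)
  where
  G = QP-euclidGcd k A₁ A₂
  U = QP-bezout₁ k A₁ A₂
  V = QP-bezout₂ k A₁ A₂
  H = QP-euclidGcd l G A₃
  B = QP-fdiv A₃ H
  sμ = QP-* (QP-bezout₁ l G A₃) (QP-fdiv M H)
  wμ = QP-* (QP-bezout₂ l G A₃) (QP-fdiv M H)
  T = QP-fmod sμ B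
  Z = QP-+ (QP-+ (QP-fdiv sμ B) (QP-fdiv wμ (QP-fdiv G H))) (QP-const 1ℤ)

-- The budgets are obtained in succession because later runs of the algorithm act on
-- quasi-polynomials that are built with the earlier budgets.
QP-p : ∀ {a₁ a₂ a₃ m} → QP a₁ → QP a₂ → QP a₃ → QP m →
       Eventually (λ n → 1ℤ ≤ a₁ n) → Eventually (λ n → 1ℤ ≤ a₂ n) →
       Eventually (λ n → 1ℤ ≤ a₃ n) → Eventually (λ n → 1ℤ ≤ m n) →
       ∃[ g ] QP g × CountsEventually a₁ a₂ a₃ m g
QP-p {a₁} {a₂} {a₃} {m} A₁ A₂ A₃ M a₁≥1 a₂≥1 a₃≥1 m≥1 =
  first (boundedEuclid A₁ A₂ (ev-map (λ _ → 1≤⇒0≤) a₂≥1))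
  where
  Result : Set
  Result = ∃[ g ] QP g × CountsEventually a₁ a₂ a₃ m g
  first : BoundedEuclid a₁ a₂ → Result
  first (k , t₁₂) = second (boundedEuclid G A₃ (ev-map (λ _ → 1≤⇒0≤) a₃≥1))
   where
   g u v : ℕ → ℤ
   g n = euclidGcd k (a₁ n) (a₂ n)
   u n = bezout₁ k (a₁ n) (a₂ n)
   v n = bezout₂ k (a₁ n) (a₂ n)
   G : QP g
   G = QP-euclidGcd k A₁ A₂
   cofactors : Eventually (λ n → Cofactors (a₁ n) (a₂ n) (g n) (u n) (v n))
   cofactors = ev-zip (λ _ (1≤a₁ , 1≤a₂) t → euclid-cofactors t 1≤a₁ 1≤a₂) (ev-× a₁≥1 a₂≥1) t₁₂
   second : BoundedEuclid g a₃ → Result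
   -- Bézout coefficients may be negative, so `u * β` and `v * β` can only serve as dividends; the
   -- divisors are the cofactors, which are eventually positive.
   second (l , t₃) = third
       (boundedEuclid (QP-* (QP-bezout₁ k A₁ A₂) B) (QP-fdiv A₂ G)
         (ev-map (λ _ c → 1≤⇒0≤ (Cofactors.1≤γ c)) cofactors))
       (boundedEuclid (QP-* (QP-bezout₂ k A₁ A₂) B) (QP-fdiv A₁ G)
         (ev-map (λ _ c → 1≤⇒0≤ (Cofactors.1≤α c)) cofactors))
     where
     β : ℕ → ℤ
     β n = fdiv (a₃ n) (euclidGcd l (g n) (a₃ n))
     B : QP β
     B = QP-fdiv A₃ (QP-euclidGcd l G A₃)
     third : BoundedEuclid (λ n → u n * β n) (λ n → fdiv (a₂ n) (g n)) →
             BoundedEuclid (λ n → v n * β n) (λ n → fdiv (a₁ n) (g n)) → Result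
     third (i , tᵤ) (j , tᵥ) = _ , QP-count k l i j A₁ A₂ A₃ M ,
       ev-zip (λ n ((t₁ , t₂) , (t₃ , t₄)) ((1≤a₁ , 1≤a₂) , (1≤a₃ , 1≤m)) →
           let pos₁ = positive (+1≤⇒< {0ℤ} 1≤a₁)
               pos₂ = positive (+1≤⇒< {0ℤ} 1≤a₂)
               pos₃ = positive (+1≤⇒< {0ℤ} 1≤a₃)
           in pos₁ , pos₂ , pos₃ ,
              Count.count-correct k l i j (a₁ n) (a₂ n) (a₃ n) (m n) t₁ t₂ t₃ t₄
                1≤a₁ 1≤a₂ 1≤a₃ (1≤⇒0≤ 1≤m) pos₁ pos₂ pos₃)
         (ev-× (ev-× t₁₂ t₃) (ev-× tᵤ tᵥ)) (ev-× (ev-× a₁≥1 a₂≥1) (ev-× a₃≥1 m≥1))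

corollary4p4 : (a₁ a₂ a₃ m : ℕ → ℤ)
    (qa₁ : IsQuasiPolynomial a₁) (qa₂ : IsQuasiPolynomial a₂)
    (qa₃ : IsQuasiPolynomial a₃) (qm : IsQuasiPolynomial m) →
    PositiveLeadingCoefficients qa₁ → PositiveLeadingCoefficients qa₂ →
    PositiveLeadingCoefficients qa₃ → PositiveLeadingCoefficients qm →
    ∃[ g ] IsQuasiPolynomial g ×
    Eventually (λ n →
    Σ[ pos₁ ∈ Positive (a₁ n) ] Σ[ pos₂ ∈ Positive (a₂ n) ] Σ[ pos₃ ∈ Positive (a₃ n) ]
    + p (a₁ n) (a₂ n) (a₃ n) {{pos₁}} {{pos₂}} {{pos₃}} (m n) ≡ g n)
corollary4p4 a₁ a₂ a₃ m qa₁ qa₂ qa₃ qm lead₁ lead₂ lead₃ leadₘ =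
  Product.map₂ (Product.map₁ QP⇒IsQuasiPolynomial) (QP-p
    (IsQuasiPolynomial⇒QP qa₁) (IsQuasiPolynomial⇒QP qa₂)
    (IsQuasiPolynomial⇒QP qa₃) (IsQuasiPolynomial⇒QP qm)
    (eventually-positive qa₁ lead₁) (eventually-positive qa₂ lead₂)
    (eventually-positive qa₃ lead₃) (eventually-positive qm leadₘ))
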